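{- Let $\eta,\eta'\in\Omega^*$. Then $\nu_{\eta}$ and $\nu_{\eta'}$ are strongly singular if and only if $\eta'\notin\overline{o}_-(\eta)$ and $\eta\notin\overline{o}_-(\eta')$.
   Context: $\mathbb{N}=\{1,2,3,\dots\}$, $\beta\mathbb{N}$ is its Stone–Čech compactification and $\mathbb{N}^*=\beta\mathbb{N}\setminus\mathbb{N}$, whose points are the free ultrafilters on $\mathbb{N}$. Let $\tau:\beta\mathbb{N}\to\beta\mathbb{N}$ be the continuous extension of $n\mapsto n+1$; its restriction to $\mathbb{N}^*$ is a homeomorphism of $\mathbb{N}^*$ onto itself. $\Omega^*$ is the quotient space of $\mathbb{N}^*\times[0,1]$ obtained by identifying $(\omega,1)$ with $(\tau\omega,0)$ for all $\omega\in\mathbb{N}^*$. For $s\in\mathbb{R}$, the homeomorphism $\phi^s:\Omega^*\to\Omega^*$ is $\phi^s(\omega,t)=(\tau^{[t+s]}\omega,\ t+s-[t+s])$, where $[x]$ is the largest integer not exceeding $x$. Put $o_-(\eta)=\{\phi^{ -s}(\eta): s\ge 0\}$ and let $\overline{o}_-(\eta)$ be its closure in $\Omega^*$. For $\eta=(\omega,t)\in\Omega^*$, with $\theta=2^t$, $\nu_\eta$ is the finitely additive probability measure on $\mathcal{P}(\mathbb{N})$ given by $\nu_\eta(A)=\omega\text{ - }\lim_n \frac{|A\cap\{1,\dots,[\theta\cdot 2^n]\}|}{\theta\cdot 2^n}$, the limit being taken along the ultrafilter $\omega$. Finitely additive probability measures $\mu,\nu$ on $\mathcal{P}(\mathbb{N})$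 are strongly singular if there is $D\in\mathcal{P}(\mathbb{N})$ with $\mu(D)=0$ and $\nu(D^c)=0$. -}

module Defs where

open import Algebra.Bundles using (CommutativeRing)
open import Axiom.ExcludedMiddle using (ExcludedMiddle)
open import Data.Integer.Base as ℤ using (ℤ; +_; -[1+_])
import Data.Integer.Properties as ℤ
open import Data.List.Base using (List; []; _∷_; applyUpTo; filter; length)
open import Data.List.Properties using (length-filter; length-applyUpTo; filter-≐; filter-all)
import Data.List.Relation.Unary.All as All
open import Data.Nat.Base as ℕ using (ℕ; zero; suc)
import Data.Nat.Properties as ℕ
open import Data.Product.Base using (∃; ∃-syntax; _×_; _,_; proj₁; proj₂)
open import Data.Sum.Base using (_⊎_; inj₁; inj₂; [_,_]′)
open import Data.Unit.Base using (tt)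
open import Function.Base using (_∘_; id)
open import Level using (0ℓ) renaming (suc to lsuc)
open import Relation.Binary.Bundles using (Poset)
open import Relation.Binary.Core using (Rel)
open import Relation.Binary.Definitions using (_Respects_)
open import Relation.Binary.PropositionalEquality.Core as ≡ using (_≡_)
open import Relation.Binary.Structures using (IsTotalOrder)
open import Relation.Nullary using (¬_; yes; no; contradiction)
open import Relation.Unary using (Pred; U; ∅; ｛_｝; ∁; _∩_; _∪_; _⊆_; _≐_; _≬_; _∈_; _⊢_; Empty; Satisfiable)
import Algebra.Properties.AbelianGroup
import Algebra.Properties.Ring
import Algebra.Properties.Semiring.Exp
import Algebra.Properties.Semiring.Mult
import Relation.Binary.Construct.Closure.Equivalence as EqClosure
import Relation.Binary.Construct.NonStrictToStrict as NonStrictToStrict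
import Relation.Binary.Reasoning.PartialOrder

-- The real numbers enter only through the axioms that characterise them up
-- to unique isomorphism: a Dedekind-complete ordered field.  The value of
-- 0# ⁻¹ is unconstrained and is never used.

record CompleteOrderedField : Set₁ where
  infix 4 _≤_
  infix 8 _⁻¹

  field
    commutativeRing : CommutativeRing 0ℓ 0ℓ

  open CommutativeRing commutativeRing public

  field
    _≤_          : Rel Carrier 0ℓ
    isTotalOrder : IsTotalOrder _≈_ _≤_
    +-monoˡ-≤    : ∀ {x y} z → x ≤ y → x + z ≤ y + z
    *-nonneg     : ∀ {x y} → 0# ≤ x → 0# ≤ y → 0# ≤ x * y
    0≉1          : ¬ (0# ≈ 1#)
    _⁻¹          : Carrier → Carrier
    *-inverseʳ   : ∀ {x} → ¬ (x ≈ 0#) → x * x ⁻¹ ≈ 1#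

  UpperBound : Pred Carrier 0ℓ → Pred Carrier 0ℓ
  UpperBound P u = ∀ {x} → P x → x ≤ u

  IsSupremum : Pred Carrier 0ℓ → Pred Carrier 0ℓ
  IsSupremum P s = UpperBound P s × (∀ {u} → UpperBound P u → s ≤ u)

  field
    complete : ∀ (P : Pred Carrier 0ℓ) →
               Satisfiable P → Satisfiable (UpperBound P) → Satisfiable (IsSupremum P)

module OrderedFieldProperties (ℝ : CompleteOrderedField) where

  open CompleteOrderedField ℝ public
  open IsTotalOrder isTotalOrder public
    using (antisym; total; isPartialOrder; ≤-respˡ-≈; ≤-respʳ-≈)
    renaming (refl to ≤-refl; trans to ≤-trans; reflexive to ≤-reflexive)
  open Algebra.Properties.Ring ring using (-‿distribʳ-*)
  open Algebra.Properties.AbelianGroup +-abelianGroup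
    using (⁻¹-involutive; ε⁻¹≈ε; ⁻¹-∙-comm; //-rightDividesˡ; //-rightDividesʳ)
  open Algebra.Properties.Semiring.Exp semiring public using (_^_)
  open Algebra.Properties.Semiring.Mult semiring public
    using (×-homo-+) renaming (_×_ to _·_)

  poset : Poset 0ℓ 0ℓ 0ℓ
  poset = record { isPartialOrder = isPartialOrder }

  open NonStrictToStrict _≈_ _≤_ public using (_<_; <⇒≤)
  open Relation.Binary.Reasoning.PartialOrder poset

  ≰⇒> : ∀ {x y} → ¬ (x ≤ y) → y < x
  ≰⇒> = NonStrictToStrict.≰⇒> _≈_ _≤_ sym ≤-reflexive total

  <⇒≱ : ∀ {x y} → x < y → ¬ (y ≤ x)
  <⇒≱ = NonStrictToStrict.<⇒≱ _≈_ _≤_ antisym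

  +-monoʳ-≤ : ∀ {x y} z → x ≤ y → z + x ≤ z + y
  +-monoʳ-≤ {x} {y} z x≤y = begin
    z + x  ≈⟨ +-comm z x ⟩
    x + z  ≤⟨ +-monoˡ-≤ z x≤y ⟩
    y + z  ≈⟨ +-comm y z ⟩
    z + y  ∎

  +-mono-≤ : ∀ {x y u v} → x ≤ y → u ≤ v → x + u ≤ y + v
  +-mono-≤ {y = y} {u = u} x≤y u≤v = ≤-trans (+-monoˡ-≤ u x≤y) (+-monoʳ-≤ y u≤v)

  +-cancelʳ-≤ : ∀ {x y} z → x + z ≤ y + z → x ≤ y
  +-cancelʳ-≤ {x} {y} z le = begin
    x            ≈⟨ //-rightDividesʳ z x ⟨
    x + z - z    ≤⟨ +-monoˡ-≤ (- z) le ⟩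
    y + z - z    ≈⟨ //-rightDividesʳ z y ⟩
    y            ∎

  +-monoˡ-< : ∀ {x y} z → x < y → x + z < y + z
  +-monoˡ-< z x<y = ≰⇒> (<⇒≱ x<y ∘ +-cancelʳ-≤ z)

  +-monoʳ-< : ∀ {x y} z → x < y → z + x < z + y
  +-monoʳ-< {x} {y} z x<y = begin-strict
    z + x  ≈⟨ +-comm z x ⟩
    x + z  <⟨ +-monoˡ-< z x<y ⟩
    y + z  ≈⟨ +-comm y z ⟩
    z + y  ∎

  x+z≤y⇒x≤y-z : ∀ {x y} z → x + z ≤ y → x ≤ y - z
  x+z≤y⇒x≤y-z {x} {y} z le = begin
    x          ≈⟨ //-rightDividesʳ z x ⟨
    x + z - z  ≤⟨ +-monoˡ-≤ (- z) le ⟩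
    y - z      ∎

  x≤y+z⇒x-z≤y : ∀ {x y} z → x ≤ y + z → x - z ≤ y
  x≤y+z⇒x-z≤y {x} {y} z le = begin
    x - z      ≤⟨ +-monoˡ-≤ (- z) le ⟩
    y + z - z  ≈⟨ //-rightDividesʳ z y ⟩
    y          ∎

  x≤0⇒0≤-x : ∀ {x} → x ≤ 0# → 0# ≤ - x
  x≤0⇒0≤-x {x} x≤0 = begin
    0#       ≤⟨ x+z≤y⇒x≤y-z x (≤-trans (≤-reflexive (+-identityˡ x)) x≤0) ⟩
    0# - x   ≈⟨ +-identityˡ (- x) ⟩
    - x      ∎

  x<x+ε : ∀ {x ε} → 0# < ε → x < x + ε
  x<x+ε {x} {ε} 0<ε = begin-strict
    x       ≈⟨ +-identityʳ x ⟨
    x + 0#  <⟨ +-monoʳ-< x 0<ε ⟩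
    x + ε   ∎

  *-monoʳ-≤ : ∀ {x y z} → 0# ≤ z → x ≤ y → z * x ≤ z * y
  *-monoʳ-≤ {x} {y} {z} 0≤z x≤y = begin
    z * x                    ≈⟨ +-identityˡ _ ⟨
    0# + z * x               ≤⟨ +-monoˡ-≤ (z * x) (*-nonneg 0≤z 0≤y-x) ⟩
    z * (y - x) + z * x      ≈⟨ distribˡ z (y - x) x ⟨
    z * (y - x + x)          ≈⟨ *-congˡ (//-rightDividesˡ x y) ⟩
    z * y                    ∎
    where
    0≤y-x : 0# ≤ y - x
    0≤y-x = x+z≤y⇒x≤y-z x (≤-trans (≤-reflexive (+-identityˡ x)) x≤y)

  *-monoˡ-≤ : ∀ {x y z} → 0# ≤ z → x ≤ y → x * z ≤ y * z
  *-monoˡ-≤ {x} {y} {z} 0≤z x≤y = begin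
    x * z  ≈⟨ *-comm x z ⟩
    z * x  ≤⟨ *-monoʳ-≤ 0≤z x≤y ⟩
    z * y  ≈⟨ *-comm z y ⟩
    y * z  ∎

  0≤1 : 0# ≤ 1#
  0≤1 with total 0# 1#
  ... | inj₁ 0≤1 = 0≤1
  ... | inj₂ 1≤0 = begin
    0#             ≤⟨ *-nonneg (x≤0⇒0≤-x 1≤0) (x≤0⇒0≤-x 1≤0) ⟩
    - 1# * - 1#    ≈⟨ -‿distribʳ-* (- 1#) 1# ⟨
    - (- 1# * 1#)  ≈⟨ -‿cong (*-identityʳ (- 1#)) ⟩
    - (- 1#)       ≈⟨ ⁻¹-involutive 1# ⟩
    1#             ∎

  0<1 : 0# < 1#
  0<1 = 0≤1 , 0≉1

  0<x⇒0≤x⁻¹ : ∀ {x} → 0# < x → 0# ≤ x ⁻¹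
  0<x⇒0≤x⁻¹ {x} (0≤x , 0≉x) with total 0# (x ⁻¹)
  ... | inj₁ 0≤x⁻¹ = 0≤x⁻¹
  ... | inj₂ x⁻¹≤0 = contradiction 1≤0 (<⇒≱ 0<1)
    where
    1≤0 : 1# ≤ 0#
    1≤0 = begin
      1#        ≈⟨ *-inverseʳ (0≉x ∘ sym) ⟨
      x * x ⁻¹  ≤⟨ *-monoʳ-≤ 0≤x x⁻¹≤0 ⟩
      x * 0#    ≈⟨ zeroʳ x ⟩
      0#        ∎

  ι : ℕ → Carrier
  ι n = n · 1#

  ιℤ : ℤ → Carrier
  ιℤ (+ n)     = ι n
  ιℤ -[1+ n ]  = - ι (suc n)

  2# : Carrier
  2# = 1# + 1#

  0≤ι : ∀ n → 0# ≤ ι n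
  0≤ι zero    = ≤-refl
  0≤ι (suc n) = ≤-trans (≤-reflexive (sym (+-identityˡ 0#))) (+-mono-≤ 0≤1 (0≤ι n))

  ι-mono-≤ : ∀ {m n} → m ℕ.≤ n → ι m ≤ ι n
  ι-mono-≤ {n = n} ℕ.z≤n = 0≤ι n
  ι-mono-≤ (ℕ.s≤s m≤n)   = +-monoʳ-≤ 1# (ι-mono-≤ m≤n)

  ι-cancel-≤ : ∀ {m n} → ι m ≤ ι n → m ℕ.≤ n
  ι-cancel-≤ {m} {n} le with m ℕ.≤? n
  ... | yes m≤n = m≤n
  ... | no  m≰n = contradiction (begin
    ι n + 1#   ≈⟨ +-comm _ _ ⟩
    ι (suc n)  ≤⟨ ι-mono-≤ (ℕ.≰⇒> m≰n) ⟩
    ι m        ≤⟨ le ⟩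
    ι n        ∎) (<⇒≱ (x<x+ε 0<1))

  ιℤ-⊖ : ∀ m n → ιℤ (m ℤ.⊖ n) + ι n ≈ ι m
  ιℤ-⊖ m       zero    = +-identityʳ (ι m)
  ιℤ-⊖ zero    (suc n) = -‿inverseˡ (ι (suc n))
  ιℤ-⊖ (suc m) (suc n) = begin-equality
    ιℤ (suc m ℤ.⊖ suc n) + (1# + ι n)  ≡⟨ ≡.cong (λ k → ιℤ k + ι (suc n)) (ℤ.[1+m]⊖[1+n]≡m⊖n m n) ⟩
    ιℤ (m ℤ.⊖ n) + (1# + ι n)          ≈⟨ +-congˡ (+-comm 1# (ι n)) ⟩
    ιℤ (m ℤ.⊖ n) + (ι n + 1#)          ≈⟨ +-assoc _ _ _ ⟨
    ιℤ (m ℤ.⊖ n) + ι n + 1#            ≈⟨ +-congʳ (ιℤ-⊖ m n) ⟩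
    ι m + 1#                           ≈⟨ +-comm _ _ ⟩
    1# + ι m                           ∎

  ιℤ-suc : ∀ k → ιℤ (ℤ.suc k) ≈ ιℤ k + 1#
  ιℤ-suc (+ n) = +-comm 1# (ι n)
  ιℤ-suc -[1+ zero ] = begin-equality
    0#                ≈⟨ -‿inverseˡ 1# ⟨
    - 1# + 1#         ≈⟨ +-congʳ (-‿cong (+-identityʳ 1#)) ⟨
    - ι 1 + 1#        ∎
  ιℤ-suc -[1+ suc n ] = begin-equality
    - ι (suc n)                ≈⟨ //-rightDividesˡ 1# _ ⟨
    - ι (suc n) - 1# + 1#      ≈⟨ +-congʳ (⁻¹-∙-comm _ _) ⟩
    - (ι (suc n) + 1#) + 1#    ≈⟨ +-congʳ (-‿cong (+-comm _ _)) ⟩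
    - ι (suc (suc n)) + 1#     ∎

  ιℤ-mono-≤ : ∀ {k l} → k ℤ.≤ l → ιℤ k ≤ ιℤ l
  ιℤ-mono-≤ (ℤ.+≤+ m≤n) = ι-mono-≤ m≤n
  ιℤ-mono-≤ { -[1+ m ] } {+ n} ℤ.-≤+ = ≤-trans (-ι≤0 (suc m)) (0≤ι n)
    where
    -ι≤0 : ∀ m → - ι m ≤ 0#
    -ι≤0 m = begin
      - ι m         ≈⟨ +-identityˡ _ ⟨
      0# - ι m      ≤⟨ +-monoˡ-≤ (- ι m) (0≤ι m) ⟩
      ι m - ι m     ≈⟨ -‿inverseʳ (ι m) ⟩
      0#            ∎
  ιℤ-mono-≤ { -[1+ m ] } { -[1+ n ] } (ℤ.-≤- n≤m) = +-cancelʳ-≤ (ι (suc m)) (begin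
    - ι (suc m) + ι (suc m)   ≈⟨ -‿inverseˡ _ ⟩
    0#                        ≈⟨ -‿inverseˡ _ ⟨
    - ι (suc n) + ι (suc n)   ≤⟨ +-monoʳ-≤ _ (ι-mono-≤ (ℕ.s≤s n≤m)) ⟩
    - ι (suc n) + ι (suc m)   ∎)

  1≤2 : 1# ≤ 2#
  1≤2 = <⇒≤ (x<x+ε 0<1)

  0≤2 : 0# ≤ 2#
  0≤2 = ≤-trans 0≤1 1≤2

  1≤2^ : ∀ n → 1# ≤ 2# ^ n
  1≤2^ zero    = ≤-refl
  1≤2^ (suc n) = begin
    1#            ≤⟨ 1≤2^ n ⟩
    2# ^ n        ≈⟨ *-identityˡ _ ⟨
    1# * 2# ^ n   ≤⟨ *-monoˡ-≤ (≤-trans 0≤1 (1≤2^ n)) 1≤2 ⟩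
    2# * 2# ^ n   ∎

  0≤2^ : ∀ n → 0# ≤ 2# ^ n
  0≤2^ n = ≤-trans 0≤1 (1≤2^ n)

  2^-mono-≤ : ∀ {m n} → m ℕ.≤ n → 2# ^ m ≤ 2# ^ n
  2^-mono-≤ {n = n} ℕ.z≤n = 1≤2^ n
  2^-mono-≤ (ℕ.s≤s m≤n)   = *-monoʳ-≤ 0≤2 (2^-mono-≤ m≤n)

  ι≤2^ : ∀ n → ι n ≤ 2# ^ n
  ι≤2^ zero    = 0≤1
  ι≤2^ (suc n) = begin
    1# + ι n                   ≤⟨ +-mono-≤ (1≤2^ n) (ι≤2^ n) ⟩
    2# ^ n + 2# ^ n            ≈⟨ +-cong (*-identityˡ _) (*-identityˡ _) ⟨
    1# * 2# ^ n + 1# * 2# ^ n  ≈⟨ distribʳ _ 1# 1# ⟨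
    2# * 2# ^ n                ∎

  2^≤y^ : ∀ {y} n → 2# ≤ y → 2# ^ n ≤ y ^ n
  2^≤y^ zero    2≤y = ≤-refl
  2^≤y^ {y} (suc n) 2≤y =
    ≤-trans (*-monoʳ-≤ 0≤2 (2^≤y^ n 2≤y))
            (*-monoˡ-≤ (≤-trans (0≤2^ n) (2^≤y^ n 2≤y)) 2≤y)

  1≤y^ : ∀ {y} n → 1# ≤ y → 1# ≤ y ^ n
  1≤y^ zero    1≤y = ≤-refl
  1≤y^ {y} (suc n) 1≤y = begin
    1#          ≤⟨ 1≤y ⟩
    y           ≈⟨ *-identityʳ y ⟨
    y * 1#      ≤⟨ *-monoʳ-≤ (≤-trans 0≤1 1≤y) (1≤y^ n 1≤y) ⟩
    y * y ^ n   ∎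

  ⁻¹-cong : ∀ {x y} → 0# < x → 0# < y → x ≈ y → x ⁻¹ ≈ y ⁻¹
  ⁻¹-cong {x} {y} (_ , 0≉x) (_ , 0≉y) x≈y = begin-equality
    x ⁻¹               ≈⟨ *-identityʳ _ ⟨
    x ⁻¹ * 1#          ≈⟨ *-congˡ (*-inverseʳ (0≉y ∘ sym)) ⟨
    x ⁻¹ * (y * y ⁻¹)  ≈⟨ *-assoc _ _ _ ⟨
    x ⁻¹ * y * y ⁻¹    ≈⟨ *-congʳ (*-comm _ _) ⟩
    y * x ⁻¹ * y ⁻¹    ≈⟨ *-congʳ (*-congʳ x≈y) ⟨
    x * x ⁻¹ * y ⁻¹    ≈⟨ *-congʳ (*-inverseʳ (0≉x ∘ sym)) ⟩
    1# * y ⁻¹          ≈⟨ *-identityˡ _ ⟩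
    y ⁻¹               ∎

  *-cancelʳ-≤ : ∀ {x y w} → 1# ≤ w → x * w ≤ y * w → x ≤ y
  *-cancelʳ-≤ {x} {y} {w} 1≤w le with total x y
  ... | inj₁ x≤y = x≤y
  ... | inj₂ y≤x = begin
    x          ≈⟨ //-rightDividesˡ y x ⟨
    x - y + y  ≤⟨ +-monoˡ-≤ y x-y≤0 ⟩
    0# + y     ≈⟨ +-identityˡ y ⟩
    y          ∎
    where
    0≤x-y : 0# ≤ x - y
    0≤x-y = x+z≤y⇒x≤y-z y (≤-trans (≤-reflexive (+-identityˡ y)) y≤x)

    x-y≤0 : x - y ≤ 0#
    x-y≤0 = +-cancelʳ-≤ (y * w) (begin
      x - y + y * w        ≈⟨ +-congʳ (*-identityʳ _) ⟨
      (x - y) * 1# + y * w ≤⟨ +-monoˡ-≤ (y * w) (*-monoʳ-≤ 0≤x-y 1≤w) ⟩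
      (x - y) * w + y * w  ≈⟨ distribʳ w (x - y) y ⟨
      (x - y + y) * w      ≈⟨ *-congʳ (//-rightDividesˡ y x) ⟩
      x * w                ≤⟨ le ⟩
      y * w                ≈⟨ +-identityˡ _ ⟨
      0# + y * w           ∎)

  half : Carrier → Carrier
  half ε = ε * 2# ⁻¹

  half+half : ∀ ε → half ε + half ε ≈ ε
  half+half ε = begin-equality
    ε * 2# ⁻¹ + ε * 2# ⁻¹                ≈⟨ distribˡ ε _ _ ⟨
    ε * (2# ⁻¹ + 2# ⁻¹)                  ≈⟨ *-congˡ (+-cong (*-identityˡ _) (*-identityˡ _)) ⟨
    ε * (1# * 2# ⁻¹ + 1# * 2# ⁻¹)        ≈⟨ *-congˡ (distribʳ _ 1# 1#) ⟨
    ε * (2# * 2# ⁻¹)                     ≈⟨ *-congˡ (*-inverseʳ 2≉0) ⟩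
    ε * 1#                               ≈⟨ *-identityʳ ε ⟩
    ε                                    ∎
    where
    2≉0 : ¬ (2# ≈ 0#)
    2≉0 2≈0 = <⇒≱ 0<1 (≤-trans 1≤2 (≤-reflexive 2≈0))

  0<half : ∀ {ε} → 0# < ε → 0# < half ε
  0<half {ε} 0<ε = ≰⇒> λ h≤0 → <⇒≱ 0<ε (begin
    ε                ≈⟨ half+half ε ⟨
    half ε + half ε  ≤⟨ +-mono-≤ h≤0 h≤0 ⟩
    0# + 0#          ≈⟨ +-identityˡ 0# ⟩
    0#               ∎)

  x<y⇒0<y-x : ∀ {x y} → x < y → 0# < y - x
  x<y⇒0<y-x {x} {y} x<y = begin-strict
    0#     ≈⟨ -‿inverseʳ x ⟨
    x - x  <⟨ +-monoˡ-< (- x) x<y ⟩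
    y - x  ∎

  -- ∣ x - y ∣ < ε
  Within : Carrier → Carrier → Carrier → Set
  Within ε x y = x < y + ε × y < x + ε

-- ℕ = {1, 2, 3, …}; the constructor 1+_ applied to k is the number k + 1.

record ℕ⁺ : Set where
  constructor 1+_
  field
    predecessor : ℕ

open ℕ⁺ public

toℕ : ℕ⁺ → ℕ
toℕ n = suc (predecessor n)

next : ℕ⁺ → ℕ⁺
next (1+ k) = 1+ suc k

-- The partial inverse of next, completed by prev 1 = 1.
prev : ℕ⁺ → ℕ⁺
prev (1+ k) = 1+ ℕ.pred k

-- βℕ, with n ∈ ℕ corresponding to the ultrafilter { A | n ∈ A }.

record Ultrafilter : Set₁ where
  field
    large     : Pred (Pred ℕ⁺ 0ℓ) 0ℓ
    U-large   : large U
    ∅-small   : ¬ large ∅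
    ⊆-closed  : ∀ {A B} → A ⊆ B → large A → large B
    ∩-closed  : ∀ {A B} → large A → large B → large (A ∩ B)
    ultra     : ∀ A → large A ⊎ large (∁ A)

-- ℕ* = βℕ ∖ ℕ.

record FreeUltrafilter : Set₁ where
  field
    ultrafilter : Ultrafilter
  open Ultrafilter ultrafilter public
  field
    free : ∀ n → ¬ large ｛ n ｝

  tail-large : ∀ N → large (λ n → N ℕ.≤ predecessor n)
  tail-large zero    = ⊆-closed (λ _ → ℕ.z≤n) U-large
  tail-large (suc N) with tail-large N | ultra ｛ 1+ N ｝
  ... | _   | inj₁ N-large = contradiction N-large (free (1+ N))
  ... | ≥-N | inj₂ rest    = ⊆-closed bigger (∩-closed ≥-N rest)
    where
    bigger : ∀ {n} → N ℕ.≤ predecessor n × ¬ (1+ N ≡ n) → suc N ℕ.≤ predecessor n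
    bigger (N≤k , N≢k) = ℕ.≤∧≢⇒< N≤k (N≢k ∘ ≡.cong 1+_)

open FreeUltrafilter public using (large)

infix 4 _≋_
_≋_ : Rel FreeUltrafilter (lsuc 0ℓ)
ω ≋ ω′ = large ω ≐ large ω′

pushforward : (ℕ⁺ → ℕ⁺) → Ultrafilter → Ultrafilter
pushforward f ω = record
  { large    = λ A → ω.large (f ⊢ A)
  ; U-large  = ω.U-large
  ; ∅-small  = ω.∅-small
  ; ⊆-closed = λ A⊆B → ω.⊆-closed A⊆B
  ; ∩-closed = ω.∩-closed
  ; ultra    = λ A → ω.ultra (f ⊢ A)
  }
  where module ω = Ultrafilter ω

-- The continuous extension to βℕ of a map f : ℕ → ℕ ⊆ βℕ is pushforward of
-- ultrafilters along f.

τ : FreeUltrafilter → FreeUltrafilter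
τ ω = record
  { ultrafilter = pushforward next ω.ultrafilter
  ; free        = λ n → ω.free (prev n) ∘ ω.⊆-closed λ { ≡.refl → ≡.refl }
  }
  where module ω = FreeUltrafilter ω

τ⁻¹ : FreeUltrafilter → FreeUltrafilter
τ⁻¹ ω = record
  { ultrafilter = pushforward prev ω.ultrafilter
  ; free        = λ n n-large → ω.free (next n)
      (ω.⊆-closed only-next (ω.∩-closed n-large (ω.tail-large 1)))
  }
  where
  module ω = FreeUltrafilter ω
  only-next : ∀ {n m} → n ≡ prev m × 1 ℕ.≤ predecessor m → next n ≡ m
  only-next {m = 1+ suc k} (≡.refl , _)    = ≡.refl

τ-τ⁻¹ : ∀ ω → τ (τ⁻¹ ω) ≋ ω
τ-τ⁻¹ ω =
  (λ A-large → ω.⊆-closed (λ { {1+ suc k} (a , _) → a }) (ω.∩-closed A-large (ω.tail-large 1))) ,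
  (λ A-large → ω.⊆-closed (λ { {1+ suc k} (a , _) → a }) (ω.∩-closed A-large (ω.tail-large 1)))
  where module ω = FreeUltrafilter ω

τ⁻¹-τ : ∀ ω → τ⁻¹ (τ ω) ≋ ω
τ⁻¹-τ ω = ω.⊆-closed id , ω.⊆-closed id
  where module ω = FreeUltrafilter ω

infixr 8 τ^_
τ^_ : ℤ → FreeUltrafilter → FreeUltrafilter
(τ^ + zero)       ω = ω
(τ^ + suc n)      ω = τ ((τ^ + n) ω)
(τ^ -[1+ zero ])  ω = τ⁻¹ ω
(τ^ -[1+ suc n ]) ω = τ⁻¹ ((τ^ -[1+ n ]) ω)

τ^-cong : ∀ k {ω ω′} → ω ≋ ω′ → (τ^ k) ω ≋ (τ^ k) ω′
τ^-cong (+ zero)       ω≋ω′ = ω≋ω′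
τ^-cong (+ suc n)      ω≋ω′ = proj₁ (τ^-cong (+ n) ω≋ω′) , proj₂ (τ^-cong (+ n) ω≋ω′)
τ^-cong -[1+ zero ]    ω≋ω′ = proj₁ ω≋ω′ , proj₂ ω≋ω′
τ^-cong -[1+ suc n ]   ω≋ω′ = proj₁ (τ^-cong -[1+ n ] ω≋ω′) , proj₂ (τ^-cong -[1+ n ] ω≋ω′)

τ^-τ : ∀ k ω → (τ^ k) (τ ω) ≋ (τ^ ℤ.suc k) ω
τ^-τ (+ zero)             ω = id , id
τ^-τ (+ suc n)            ω = proj₁ (τ^-τ (+ n) ω) , proj₂ (τ^-τ (+ n) ω)
τ^-τ -[1+ zero ]          ω = τ⁻¹-τ ω
τ^-τ -[1+ suc zero ]      ω = proj₁ (τ⁻¹-τ ω) , proj₂ (τ⁻¹-τ ω)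
τ^-τ -[1+ suc (suc n) ]   ω = proj₁ (τ^-τ -[1+ suc n ] ω) , proj₂ (τ^-τ -[1+ suc n ] ω)

-- Classical logic is an explicit hypothesis, at every universe level.

module Suspension (em : ∀ {ℓ} → ExcludedMiddle ℓ) (ℝ : CompleteOrderedField) where

  open OrderedFieldProperties ℝ public
  open Algebra.Properties.AbelianGroup +-abelianGroup using (⁻¹-∙-comm; //-rightDividesˡ; //-rightDividesʳ)
  open Relation.Binary.Reasoning.PartialOrder poset

  by-contradiction : ∀ {p} {P : Set p} → ¬ ¬ P → P
  by-contradiction {P = P} ¬¬p with em {P = P}
  ... | yes p = p
  ... | no ¬p = contradiction ¬p ¬¬p

  archimedean : ∀ x → ∃[ n ] x < ι n
  archimedean x = by-contradiction λ none →
    let bounded n = by-contradiction λ n≰x → none (n , ≰⇒> n≰x)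
        s , ub , least = complete (λ y → ∃[ n ] y ≈ ι n) (ι 0 , 0 , refl)
                           (x , λ (n , y≈n) → ≤-trans (≤-reflexive y≈n) (bounded n))
        s≤s-1 = least λ { {y} (n , y≈n) → x+z≤y⇒x≤y-z 1# (begin
                  y + 1#     ≈⟨ +-congʳ y≈n ⟩
                  ι n + 1#   ≈⟨ +-comm _ _ ⟩
                  ι (suc n)  ≤⟨ ub (suc n , refl) ⟩
                  s          ∎) }
    in <⇒≱ (x<x+ε 0<1) (begin
         s + 1#       ≤⟨ +-monoˡ-≤ 1# s≤s-1 ⟩
         s - 1# + 1#  ≈⟨ //-rightDividesˡ 1# s ⟩
         s            ∎)

  IsFloor : Carrier → ℤ → Set
  IsFloor x k = ιℤ k ≤ x × x < ιℤ k + 1#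

  floor-below : ∀ {x} n → 0# ≤ x → x < ι n → ∃[ m ] IsFloor x (+ m)
  floor-below zero    0≤x x<0 = contradiction 0≤x (<⇒≱ x<0)
  floor-below {x} (suc n) 0≤x x<n+1 with total (ι n) x
  ... | inj₁ n≤x = n , n≤x , (begin-strict
    x          <⟨ x<n+1 ⟩
    1# + ι n   ≈⟨ +-comm _ _ ⟩
    ι n + 1#   ∎)
  ... | inj₂ x≤n with em {P = x < ι n}
  ...   | yes x<n = floor-below n 0≤x x<n
  ...   | no  x≮n = n , n≤x , ≤-<-step (x<x+ε 0<1)
    where
    n≤x : ι n ≤ x
    n≤x = by-contradiction (x≮n ∘ ≰⇒>)
    ≤-<-step : ∀ {y} → ι n < y → x < y
    ≤-<-step {y} n<y = begin-strict
      x    ≤⟨ x≤n ⟩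
      ι n  <⟨ n<y ⟩
      y    ∎

  floor-shift : ∀ {x} m j → IsFloor (x + ι j) (+ m) → IsFloor x (m ℤ.⊖ j)
  floor-shift {x} m j (m≤y , y<m+1) =
    +-cancelʳ-≤ (ι j) (≤-trans (≤-reflexive (ιℤ-⊖ m j)) m≤y) ,
    ≰⇒> λ k+1≤x → <⇒≱ y<m+1 (begin
      ι m + 1#                    ≈⟨ +-congʳ (ιℤ-⊖ m j) ⟨
      ιℤ (m ℤ.⊖ j) + ι j + 1#     ≈⟨ +-assoc _ _ _ ⟩
      ιℤ (m ℤ.⊖ j) + (ι j + 1#)   ≈⟨ +-congˡ (+-comm _ _) ⟩
      ιℤ (m ℤ.⊖ j) + (1# + ι j)   ≈⟨ +-assoc _ _ _ ⟨
      ιℤ (m ℤ.⊖ j) + 1# + ι j     ≤⟨ +-monoˡ-≤ (ι j) k+1≤x ⟩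
      x + ι j                     ∎)

  opaque
    floor-exists : ∀ x → ∃ (IsFloor x)
    floor-exists x =
      let j , -x<j = archimedean (- x)
          n , x<n  = archimedean x
          m , isFloor = floor-below (n ℕ.+ j)
            (begin
              0#       ≈⟨ -‿inverseʳ x ⟨
              x - x    ≤⟨ +-monoʳ-≤ x (<⇒≤ -x<j) ⟩
              x + ι j  ∎)
            (begin-strict
              x + ι j        <⟨ +-monoˡ-< (ι j) x<n ⟩
              ι n + ι j      ≈⟨ ×-homo-+ 1# n j ⟨
              ι (n ℕ.+ j)    ∎)
      in m ℤ.⊖ j , floor-shift m j isFloor

  ⌊_⌋ : Carrier → ℤ
  ⌊ x ⌋ = proj₁ (floor-exists x)

  ⌊⌋-isFloor : ∀ x → IsFloor x ⌊ x ⌋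
  ⌊⌋-isFloor x = proj₂ (floor-exists x)

  floor-≤ : ∀ {x y k l} → IsFloor x k → IsFloor y l → x ≤ y → k ℤ.≤ l
  floor-≤ {x} {y} {k} {l} (k≤x , _) (_ , y<l+1) x≤y with k ℤ.≤? l
  ... | yes k≤l = k≤l
  ... | no  k≰l = contradiction (begin
    ιℤ l + 1#        ≈⟨ ιℤ-suc l ⟨
    ιℤ (ℤ.suc l)     ≤⟨ ιℤ-mono-≤ (ℤ.i<j⇒suc[i]≤j (ℤ.≰⇒> k≰l)) ⟩
    ιℤ k             ≤⟨ k≤x ⟩
    x                ≤⟨ x≤y ⟩
    y                ∎) (<⇒≱ y<l+1)

  floor-unique : ∀ {x y k l} → IsFloor x k → IsFloor y l → x ≈ y → k ≡ l
  floor-unique x-k y-l x≈y =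
    ℤ.≤-antisym (floor-≤ x-k y-l (≤-reflexive x≈y)) (floor-≤ y-l x-k (≤-reflexive (sym x≈y)))

  ⌊⌋-cong : ∀ {x y} → x ≈ y → ⌊ x ⌋ ≡ ⌊ y ⌋
  ⌊⌋-cong = floor-unique (⌊⌋-isFloor _) (⌊⌋-isFloor _)

  ⌊1+⌋ : ∀ {x y} → x ≈ y + 1# → ⌊ x ⌋ ≡ ℤ.suc ⌊ y ⌋
  ⌊1+⌋ {x} {y} = floor-unique (⌊⌋-isFloor x)
    ( ≤-trans (≤-reflexive (ιℤ-suc ⌊ y ⌋)) (+-monoˡ-≤ 1# (proj₁ (⌊⌋-isFloor y)))
    , (begin-strict
        y + 1#                   <⟨ +-monoˡ-< 1# (proj₂ (⌊⌋-isFloor y)) ⟩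
        ιℤ ⌊ y ⌋ + 1# + 1#       ≈⟨ +-congʳ (ιℤ-suc ⌊ y ⌋) ⟨
        ιℤ (ℤ.suc ⌊ y ⌋) + 1#    ∎))

  ι∣k∣≈ : ∀ {y} → 0# ≤ y → ∀ k → IsFloor y k → ι ℤ.∣ k ∣ ≈ ιℤ k
  ι∣k∣≈ 0≤y (+ m)    _          = refl
  ι∣k∣≈ {y} 0≤y -[1+ m ] (_ , y<-m) = contradiction 0≤y (<⇒≱ (begin-strict
    y                     <⟨ y<-m ⟩
    - ι (suc m) + 1#      ≈⟨ +-comm _ _ ⟩
    1# - ι (suc m)        ≤⟨ x≤y+z⇒x-z≤y (ι (suc m)) 1≤m ⟩
    0#                    ∎))
    where
    1≤m : 1# ≤ 0# + ι (suc m)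
    1≤m = begin
      1#              ≈⟨ +-identityʳ 1# ⟨
      ι 1             ≤⟨ ι-mono-≤ {1} {suc m} (ℕ.s≤s ℕ.z≤n) ⟩
      ι (suc m)       ≈⟨ +-identityˡ _ ⟨
      0# + ι (suc m)  ∎

  record UnitInterval : Set where
    field
      value   : Carrier
      0≤value : 0# ≤ value
      value≤1 : value ≤ 1#

  open UnitInterval public

  fractional : Carrier → UnitInterval
  fractional x = record
    { value   = x - ιℤ ⌊ x ⌋
    ; 0≤value = x+z≤y⇒x≤y-z _ (≤-trans (≤-reflexive (+-identityˡ _)) (proj₁ (⌊⌋-isFloor x)))
    ; value≤1 = x≤y+z⇒x-z≤y _ (≤-trans (<⇒≤ (proj₂ (⌊⌋-isFloor x))) (≤-reflexive (+-comm _ _)))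
    }

  -- For t ∈ [0,1], 2 ^ t is the supremum of the 2 ^ r with r = p / (k + 1) ≤ t,
  -- where 2 ^ r is the non-negative (k + 1)-th root of 2 ^ p.

  RationalPower : UnitInterval → Pred Carrier 0ℓ
  RationalPower t y =
    0# ≤ y × ∃[ p ] ∃[ k ] (ι p ≤ ι (suc k) * value t × y ^ suc k ≈ 2# ^ p)

  1-isRationalPower : ∀ t → RationalPower t 1#
  1-isRationalPower t = 0≤1 , 0 , 0 , *-nonneg (0≤ι 1) (0≤value t) , *-identityʳ 1#

  RationalPower≤2 : ∀ t → UpperBound (RationalPower t) 2#
  RationalPower≤2 t {y} (0≤y , p , k , p≤kt , y^k≈2^p) with total y 2#
  ... | inj₁ y≤2 = y≤2
  ... | inj₂ 2≤y = *-cancelʳ-≤ (≤-trans (1≤2^ k) (2^≤y^ k 2≤y)) (begin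
    y * y ^ k     ≈⟨ y^k≈2^p ⟩
    2# ^ p        ≤⟨ 2^-mono-≤ {p} {suc k} p≤k ⟩
    2# * 2# ^ k   ≤⟨ *-monoʳ-≤ 0≤2 (2^≤y^ k 2≤y) ⟩
    2# * y ^ k    ∎)
    where
    p≤k : p ℕ.≤ suc k
    p≤k = ι-cancel-≤ (begin
      ι p                  ≤⟨ p≤kt ⟩
      ι (suc k) * value t  ≤⟨ *-monoʳ-≤ (0≤ι (suc k)) (value≤1 t) ⟩
      ι (suc k) * 1#       ≈⟨ *-identityʳ _ ⟩
      ι (suc k)            ∎)

  2^-exists : ∀ t → Satisfiable (IsSupremum (RationalPower t))
  2^-exists t = complete (RationalPower t)
    (1# , 1-isRationalPower t) (2# , λ {y} → RationalPower≤2 t {y})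

  2^[_] : UnitInterval → Carrier
  2^[ t ] = proj₁ (2^-exists t)

  1≤2^[_] : ∀ t → 1# ≤ 2^[ t ]
  1≤2^[ t ] = proj₁ (proj₂ (2^-exists t)) (1-isRationalPower t)

  2^-cong : ∀ {t t′} → value t ≈ value t′ → 2^[ t ] ≈ 2^[ t′ ]
  2^-cong {t} {t′} t≈t′ = antisym (below t t′ t≈t′) (below t′ t (sym t≈t′))
    where
    below : ∀ t t′ → value t ≈ value t′ → 2^[ t ] ≤ 2^[ t′ ]
    below t t′ t≈t′ = proj₂ (proj₂ (2^-exists t)) λ { (0≤y , p , k , p≤kt , y^k≈2^p) →
      proj₁ (proj₂ (2^-exists t′))
        (0≤y , p , k , ≤-trans p≤kt (≤-reflexive (*-congˡ t≈t′)) , y^k≈2^p) }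

  2^1≈2 : ∀ {t} → value t ≈ 1# → 2^[ t ] ≈ 2#
  2^1≈2 {t} t≈1 = antisym
    (proj₂ (proj₂ (2^-exists t)) λ {y} → RationalPower≤2 t {y})
    (proj₁ (proj₂ (2^-exists t))
      (0≤2 , 1 , 0 , ≤-reflexive (trans (sym (*-identityʳ _)) (*-congˡ (sym t≈1))) , refl))

  2^0≈1 : ∀ {t} → value t ≈ 0# → 2^[ t ] ≈ 1#
  2^0≈1 {t} t≈0 = antisym (proj₂ (proj₂ (2^-exists t)) λ {y} → ≤1 {y}) 1≤2^[ t ]
    where
    ≤1 : UpperBound (RationalPower t) 1#
    ≤1 {y} (_ , p , k , p≤kt , y^k≈2^p) with total y 1#
    ... | inj₁ y≤1 = y≤1
    ... | inj₂ 1≤y = *-cancelʳ-≤ (1≤y^ k 1≤y) (begin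
      y * y ^ k     ≈⟨ y^k≈2^p ⟩
      2# ^ p        ≤⟨ 2^-mono-≤ p≤0 ⟩
      1#            ≤⟨ 1≤y^ k 1≤y ⟩
      y ^ k         ≈⟨ *-identityˡ _ ⟨
      1# * y ^ k    ∎)
      where
      p≤0 : p ℕ.≤ 0
      p≤0 = ι-cancel-≤ (≤-trans p≤kt (≤-reflexive (trans (*-congˡ t≈0) (zeroʳ _))))

  -- The points of Ω* are represented by pairs (ω , t) with t ∈ [0,1], equal when
  -- related by _∼_, the equivalence generated by (ω , 1) ∼ (τ ω , 0) and by
  -- extensional equality of ultrafilters and of reals.  φ-cong and ν-cong below
  -- show that φ and ν depend only on the point represented.

  Ω* : Set₁
  Ω* = FreeUltrafilter × UnitInterval

  data Identified : Rel Ω* (lsuc 0ℓ) where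
    equal : ∀ {ω ω′ t t′} → ω ≋ ω′ → value t ≈ value t′ → Identified (ω , t) (ω′ , t′)
    glue  : ∀ {ω ω′ t t′} → value t ≈ 1# → ω′ ≋ τ ω → value t′ ≈ 0# →
            Identified (ω , t) (ω′ , t′)

  infix 4 _∼_
  _∼_ : Rel Ω* (lsuc 0ℓ)
  _∼_ = EqClosure.EqClosure Identified

  -- The quotient topology: saturated sets open in ℕ* × [0,1], where the sets
  -- { ω | A ∈ ω } form a basis of the topology of ℕ*.  By excluded middle, no
  -- open set is lost by taking V in the lowest universe.

  record IsOpen (V : Pred Ω* 0ℓ) : Set₁ where
    field
      saturated    : V Respects _∼_
      neighborhood : ∀ {ω t} → (ω , t) ∈ V →
        ∃[ A ] ∃[ ε ] (large ω A × 0# < ε ×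
          (∀ {ω′ t′} → large ω′ A → Within ε (value t′) (value t) → (ω′ , t′) ∈ V))

  closure : ∀ {ℓ} → Pred Ω* ℓ → Pred Ω* _
  closure S η = ∀ V → IsOpen V → η ∈ V → S ≬ V

  φ : Carrier → Ω* → Ω*
  φ s (ω , t) = (τ^ ⌊ value t + s ⌋) ω , fractional (value t + s)

  φ-cong : ∀ s {η η′} → η ∼ η′ → φ s η ∼ φ s η′
  φ-cong s = EqClosure.gmap (φ s) step
    where
    step : ∀ {η η′} → Identified η η′ → Identified (φ s η) (φ s η′)
    step {ω , t} {ω′ , t′} (equal ω≋ω′ t≈t′) = equal
      (≡.subst (λ k → (τ^ k) ω ≋ (τ^ ⌊ value t′ + s ⌋) ω′) (≡.sym (⌊⌋-cong (+-congʳ t≈t′)))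
        (τ^-cong ⌊ value t′ + s ⌋ ω≋ω′))
      (+-cong (+-congʳ t≈t′) (-‿cong (reflexive (≡.cong ιℤ (⌊⌋-cong (+-congʳ t≈t′))))))
    step {ω , t} {ω′ , t′} (glue t≈1 ω′≋τω t′≈0) = equal
      (≡.subst (λ k → (τ^ k) ω ≋ (τ^ l) ω′) (≡.sym ⌊⌋≡)
        (proj₁ shift ∘ proj₂ (τ^-τ l ω) , proj₁ (τ^-τ l ω) ∘ proj₂ shift))
      (begin-equality
        value t + s - ιℤ ⌊ value t + s ⌋        ≈⟨ +-cong t+s≈ (-‿cong (reflexive (≡.cong ιℤ ⌊⌋≡))) ⟩
        value t′ + s + 1# - ιℤ (ℤ.suc l)        ≈⟨ +-congˡ (-‿cong (trans (ιℤ-suc l) (+-comm _ _))) ⟩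
        value t′ + s + 1# - (1# + ιℤ l)         ≈⟨ +-congˡ (⁻¹-∙-comm _ _) ⟨
        value t′ + s + 1# + (- 1# - ιℤ l)       ≈⟨ +-assoc _ _ _ ⟨
        value t′ + s + 1# - 1# - ιℤ l           ≈⟨ +-congʳ (//-rightDividesʳ 1# _) ⟩
        value t′ + s - ιℤ l                     ∎)
      where
      l = ⌊ value t′ + s ⌋

      shift : (τ^ l) (τ ω) ≋ (τ^ l) ω′
      shift = τ^-cong l {τ ω} {ω′} (proj₂ ω′≋τω , proj₁ ω′≋τω)

      t+s≈ : value t + s ≈ value t′ + s + 1#
      t+s≈ = begin-equality
        value t + s          ≈⟨ +-congʳ t≈1 ⟩
        1# + s               ≈⟨ +-comm _ _ ⟩
        s + 1#               ≈⟨ +-congʳ (+-identityˡ s) ⟨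
        0# + s + 1#          ≈⟨ +-congʳ (+-congʳ t′≈0) ⟨
        value t′ + s + 1#    ∎

      ⌊⌋≡ : ⌊ value t + s ⌋ ≡ ℤ.suc l
      ⌊⌋≡ = ⌊1+⌋ t+s≈

  o₋ : Ω* → Pred Ω* (lsuc 0ℓ)
  o₋ η ζ = ∃[ s ] (0# ≤ s × ζ ∼ φ (- s) η)

  IsLimit : FreeUltrafilter → (ℕ⁺ → Carrier) → Pred Carrier 0ℓ
  IsLimit ω x L = ∀ {ε} → 0# < ε → large ω (λ n → Within ε (x n) L)

  Bounded : Pred (ℕ⁺ → Carrier) 0ℓ
  Bounded x = ∃[ a ] ∃[ b ] ∀ n → a ≤ x n × x n ≤ b

  EventuallyAbove : FreeUltrafilter → (ℕ⁺ → Carrier) → Pred Carrier 0ℓ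
  EventuallyAbove ω x y = large ω (λ n → y ≤ x n)

  supremum-isLimit : ∀ ω {x L} → IsSupremum (EventuallyAbove ω x) L → IsLimit ω x L
  supremum-isLimit ω {x} {L} (upper , least) {ε} 0<ε = ω.∩-closed below above
    where
    module ω = FreeUltrafilter ω

    below : large ω (λ n → x n < L + ε)
    below with ω.ultra (λ n → x n < L + ε)
    ... | inj₁ yes-large = yes-large
    ... | inj₂ no-large  = contradiction
      (upper (ω.⊆-closed (λ x≮ → by-contradiction (x≮ ∘ ≰⇒>)) no-large))
      (<⇒≱ (x<x+ε 0<ε))

    L-ε<L : L - ε < L
    L-ε<L = ≰⇒> λ L≤L-ε → <⇒≱ (x<x+ε 0<ε) (begin
      L + ε      ≤⟨ +-monoˡ-≤ ε L≤L-ε ⟩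
      L - ε + ε  ≈⟨ //-rightDividesˡ ε L ⟩
      L          ∎)

    above : large ω (λ n → L < x n + ε)
    above with ω.ultra (λ n → L < x n + ε)
    ... | inj₁ yes-large = yes-large
    ... | inj₂ no-large  = contradiction
      (least λ {y} y-above → by-contradiction λ y≰L-ε →
        ω.∅-small (ω.⊆-closed
          (λ {n} (y≤x , L≮) → L≮ (begin-strict
            L          ≈⟨ //-rightDividesˡ ε L ⟨
            L - ε + ε  <⟨ +-monoˡ-< ε (≰⇒> y≰L-ε) ⟩
            y + ε      ≤⟨ +-monoˡ-≤ ε y≤x ⟩
            x n + ε    ∎))
          (ω.∩-closed y-above no-large)))
      (<⇒≱ L-ε<L)

  EventuallyAbove≤ : ∀ ω {x b} → (∀ n → x n ≤ b) → UpperBound (EventuallyAbove ω x) b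
  EventuallyAbove≤ ω x≤b y-above = by-contradiction λ y≰b →
    ω.∅-small (ω.⊆-closed (λ {n} y≤x → y≰b (≤-trans y≤x (x≤b n))) y-above)
    where module ω = FreeUltrafilter ω

  opaque
    limit-exists : ∀ ω {x} → Bounded x → ∃ (IsLimit ω x)
    limit-exists ω {x} (a , b , a≤x≤b) =
      let L , L-sup = complete (EventuallyAbove ω x)
            (a , FreeUltrafilter.⊆-closed ω (λ {n} _ → proj₁ (a≤x≤b n)) (FreeUltrafilter.U-large ω))
            (b , EventuallyAbove≤ ω (λ n → proj₂ (a≤x≤b n)))
      in L , supremum-isLimit ω L-sup

  limit : ∀ ω {x} → Bounded x → Carrier
  limit ω bounded = proj₁ (limit-exists ω bounded)

  limit-isLimit : ∀ ω {x} (bounded : Bounded x) → IsLimit ω x (limit ω bounded)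
  limit-isLimit ω bounded = proj₂ (limit-exists ω bounded)

  limit-mono : ∀ ω {x y L M} → IsLimit ω x L → IsLimit ω y M → (∀ n → x n ≤ y n) → L ≤ M
  limit-mono ω {x} {y} {L} {M} x→L y→M x≤y = by-contradiction λ L≰M →
    let 0<h = 0<half (x<y⇒0<y-x (≰⇒> L≰M))
        h   = half (L - M)
    in ω.∅-small (ω.⊆-closed
         (λ {n} ((_ , L<x+h) , (y<M+h , _)) → <⇒≱ L<x+h (begin
           x n + h       ≤⟨ +-monoˡ-≤ h (≤-trans (x≤y n) (<⇒≤ y<M+h)) ⟩
           M + h + h     ≈⟨ +-assoc M h h ⟩
           M + (h + h)   ≈⟨ +-congˡ (half+half (L - M)) ⟩
           M + (L - M)   ≈⟨ +-comm _ _ ⟩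
           L - M + M     ≈⟨ //-rightDividesˡ M L ⟩
           L             ∎))
         (ω.∩-closed (x→L 0<h) (y→M 0<h)))
    where module ω = FreeUltrafilter ω

  limit-unique : ∀ ω {x y L M} → IsLimit ω x L → IsLimit ω y M → (∀ n → x n ≈ y n) → L ≈ M
  limit-unique ω x→L y→M x≈y = antisym
    (limit-mono ω x→L y→M (≤-reflexive ∘ x≈y)) (limit-mono ω y→M x→L (≤-reflexive ∘ sym ∘ x≈y))

  limit-const : ∀ ω L → IsLimit ω (λ _ → L) L
  limit-const ω L 0<ε = ω.⊆-closed (λ _ → x<x+ε 0<ε , x<x+ε 0<ε) ω.U-large
    where module ω = FreeUltrafilter ω

  limit-+ : ∀ ω {x y L M} → IsLimit ω x L → IsLimit ω y M → IsLimit ω (λ n → x n + y n) (L + M)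
  limit-+ ω x→L y→M {ε} 0<ε = ω.⊆-closed
    (λ ((x<L , L<x) , (y<M , M<y)) → add x<L y<M , add L<x M<y)
    (ω.∩-closed (x→L (0<half 0<ε)) (y→M (0<half 0<ε)))
    where
    module ω = FreeUltrafilter ω
    h = half ε

    add : ∀ {a b c d} → a < b + h → c < d + h → a + c < b + d + ε
    add {a} {b} {c} {d} a<b+h c<d+h = begin-strict
      a + c              <⟨ +-monoˡ-< c a<b+h ⟩
      b + h + c          <⟨ +-monoʳ-< (b + h) c<d+h ⟩
      b + h + (d + h)    ≈⟨ +-assoc b h (d + h) ⟩
      b + (h + (d + h))  ≈⟨ +-congˡ (+-comm h (d + h)) ⟩
      b + (d + h + h)    ≈⟨ +-congˡ (+-assoc d h h) ⟩
      b + (d + (h + h))  ≈⟨ +-assoc b d (h + h) ⟨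
      b + d + (h + h)    ≈⟨ +-congˡ (half+half ε) ⟩
      b + d + ε          ∎

  countIn : Pred ℕ⁺ 0ℓ → List ℕ⁺ → ℕ
  countIn A ns = length (filter (λ n → em {P = A n}) ns)

  -- ∣ A ∩ {1, …, N} ∣
  count : Pred ℕ⁺ 0ℓ → ℕ → ℕ
  count A N = countIn A (applyUpTo 1+_ N)

  count≤ : ∀ A N → count A N ℕ.≤ N
  count≤ A N = ℕ.≤-trans (length-filter (λ n → em {P = A n}) (applyUpTo 1+_ N))
                         (ℕ.≤-reflexive (length-applyUpTo 1+_ N))

  countIn-∪ : ∀ {A B} → Empty (A ∩ B) → ∀ ns → countIn (A ∪ B) ns ≡ countIn A ns ℕ.+ countIn B ns
  countIn-∪ disjoint [] = ≡.refl
  countIn-∪ {A} {B} disjoint (n ∷ ns)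
    with em {P = A n} | em {P = B n} | em {P = A n ⊎ B n} | countIn-∪ {A} {B} disjoint ns
  ... | yes a | yes b | _      | _  = contradiction (a , b) (disjoint n)
  ... | yes a | no ¬b | yes _  | ih = ≡.cong suc ih
  ... | yes a | no ¬b | no ¬ab | _  = contradiction (inj₁ a) ¬ab
  ... | no ¬a | yes b | yes _  | ih = ≡.trans (≡.cong suc ih) (≡.sym (ℕ.+-suc _ _))
  ... | no ¬a | yes b | no ¬ab | _  = contradiction (inj₂ b) ¬ab
  ... | no ¬a | no ¬b | yes ab | _  = contradiction ab [ ¬a , ¬b ]′
  ... | no ¬a | no ¬b | no _   | ih = ih

  scale : Ω* → ℕ⁺ → Carrier
  scale (ω , t) n = 2^[ t ] * 2# ^ toℕ n

  density : Ω* → Pred ℕ⁺ 0ℓ → ℕ⁺ → Carrier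
  density η A n = ι (count A ℤ.∣ ⌊ scale η n ⌋ ∣) * scale η n ⁻¹

  2^n≤scale : ∀ η n → 2# ^ toℕ n ≤ scale η n
  2^n≤scale (ω , t) n = begin
    2# ^ toℕ n            ≈⟨ *-identityˡ _ ⟨
    1# * 2# ^ toℕ n       ≤⟨ *-monoˡ-≤ (0≤2^ (toℕ n)) 1≤2^[ t ] ⟩
    2^[ t ] * 2# ^ toℕ n  ∎

  0<scale : ∀ η n → 0# < scale η n
  0<scale η n = begin-strict
    0#          <⟨ 0<1 ⟩
    1#          ≤⟨ 1≤2^ (toℕ n) ⟩
    2# ^ toℕ n  ≤⟨ 2^n≤scale η n ⟩
    scale η n   ∎

  scale-inverse : ∀ η n → scale η n * scale η n ⁻¹ ≈ 1#
  scale-inverse η n = *-inverseʳ (proj₂ (0<scale η n) ∘ sym)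

  ι∣⌊scale⌋∣≈ : ∀ η n → ι ℤ.∣ ⌊ scale η n ⌋ ∣ ≈ ιℤ ⌊ scale η n ⌋
  ι∣⌊scale⌋∣≈ η n = ι∣k∣≈ (<⇒≤ (0<scale η n)) ⌊ scale η n ⌋ (⌊⌋-isFloor (scale η n))

  0≤density : ∀ η A n → 0# ≤ density η A n
  0≤density η A n = *-nonneg (0≤ι (count A ℤ.∣ ⌊ scale η n ⌋ ∣)) (0<x⇒0≤x⁻¹ (0<scale η n))

  density≤1 : ∀ η A n → density η A n ≤ 1#
  density≤1 η A n = begin
    ι (count A N) * scale η n ⁻¹  ≤⟨ *-monoˡ-≤ (0<x⇒0≤x⁻¹ (0<scale η n)) (begin
      ι (count A N)                ≤⟨ ι-mono-≤ {count A N} {N} (count≤ A N) ⟩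
      ι N                          ≈⟨ ι∣⌊scale⌋∣≈ η n ⟩
      ιℤ ⌊ scale η n ⌋             ≤⟨ proj₁ (⌊⌋-isFloor (scale η n)) ⟩
      scale η n                    ∎) ⟩
    scale η n * scale η n ⁻¹       ≈⟨ scale-inverse η n ⟩
    1#                             ∎
    where N = ℤ.∣ ⌊ scale η n ⌋ ∣

  density-bounded : ∀ η A → Bounded (density η A)
  density-bounded η A = 0# , 1# , λ n → 0≤density η A n , density≤1 η A n

  record FinitelyAdditiveProbability : Set₁ where
    field
      measure  : Pred ℕ⁺ 0ℓ → Carrier
      cong     : ∀ {A B} → A ≐ B → measure A ≈ measure B
      nonneg   : ∀ A → 0# ≤ measure A
      total    : measure U ≈ 1#
      additive : ∀ {A B} → Empty (A ∩ B) → measure (A ∪ B) ≈ measure A + measure B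

  open FinitelyAdditiveProbability public using (measure)

  -- ω-lim ∣ A ∩ {1, …, ⌊θ 2 ^ n⌋} ∣ / (θ 2 ^ n), with θ = 2 ^ t.
  densityLimit : Ω* → Pred ℕ⁺ 0ℓ → Carrier
  densityLimit η@(ω , _) A = limit ω (density-bounded η A)

  densityLimit-isLimit : ∀ η A → IsLimit (proj₁ η) (density η A) (densityLimit η A)
  densityLimit-isLimit η@(ω , _) A = limit-isLimit ω (density-bounded η A)

  densityLimit-cong : ∀ η {A B} → A ≐ B → densityLimit η A ≈ densityLimit η B
  densityLimit-cong η {A} {B} A≐B = limit-unique (proj₁ η)
    (densityLimit-isLimit η A) (densityLimit-isLimit η B)
    λ n → reflexive (≡.cong (λ ns → ι (length ns) * scale η n ⁻¹)
            (filter-≐ (λ n → em {P = A n}) (λ n → em {P = B n}) A≐B (applyUpTo 1+_ ℤ.∣ ⌊ scale η n ⌋ ∣)))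

  densityLimit-∪ : ∀ η {A B} → Empty (A ∩ B) → densityLimit η (A ∪ B) ≈ densityLimit η A + densityLimit η B
  densityLimit-∪ η {A} {B} disjoint = limit-unique (proj₁ η)
    (densityLimit-isLimit η (A ∪ B))
    (limit-+ (proj₁ η) (densityLimit-isLimit η A) (densityLimit-isLimit η B))
    λ n → let N = ℤ.∣ ⌊ scale η n ⌋ ∣ in begin-equality
      ι (count (A ∪ B) N) * scale η n ⁻¹
        ≡⟨ ≡.cong (λ c → ι c * scale η n ⁻¹) (countIn-∪ {A} {B} disjoint (applyUpTo 1+_ N)) ⟩
      ι (count A N ℕ.+ count B N) * scale η n ⁻¹
        ≈⟨ *-congʳ (×-homo-+ 1# (count A N) (count B N)) ⟩
      (ι (count A N) + ι (count B N)) * scale η n ⁻¹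
        ≈⟨ distribʳ _ _ _ ⟩
      density η A n + density η B n  ∎

  count-U : ∀ N → count U N ≡ N
  count-U N = ≡.trans
    (≡.cong length (filter-all (λ n → em {P = U n}) {applyUpTo 1+_ N} (All.universal (λ _ → tt) _)))
    (length-applyUpTo 1+_ N)

  densityLimit-U : ∀ η → densityLimit η U ≈ 1#
  densityLimit-U η = antisym
    (limit-mono ω (densityLimit-isLimit η U) (limit-const ω 1#) (density≤1 η U))
    (1≤limit (densityLimit-isLimit η U))
    where
    ω = proj₁ η
    module ω = FreeUltrafilter ω

    scale⁻¹≤ : ∀ {ε} → 0# < ε → ∀ n → ε ⁻¹ ≤ scale η n → scale η n ⁻¹ ≤ ε
    scale⁻¹≤ {ε} 0<ε n ε⁻¹≤y = begin
      y ⁻¹                ≈⟨ *-identityˡ _ ⟨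
      1# * y ⁻¹           ≈⟨ *-congʳ (*-inverseʳ (proj₂ 0<ε ∘ sym)) ⟨
      ε * ε ⁻¹ * y ⁻¹     ≤⟨ *-monoˡ-≤ (0<x⇒0≤x⁻¹ (0<scale η n)) (*-monoʳ-≤ (<⇒≤ 0<ε) ε⁻¹≤y) ⟩
      ε * y * y ⁻¹        ≈⟨ *-assoc _ _ _ ⟩
      ε * (y * y ⁻¹)      ≈⟨ *-congˡ (scale-inverse η n) ⟩
      ε * 1#              ≈⟨ *-identityʳ ε ⟩
      ε                   ∎
      where y = scale η n

    1≤density+scale⁻¹ : ∀ n → 1# ≤ density η U n + scale η n ⁻¹
    1≤density+scale⁻¹ n = begin
      1#                              ≈⟨ scale-inverse η n ⟨
      y * y ⁻¹                        ≤⟨ *-monoˡ-≤ (0<x⇒0≤x⁻¹ (0<scale η n)) (<⇒≤ (proj₂ (⌊⌋-isFloor y))) ⟩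
      (ιℤ ⌊ y ⌋ + 1#) * y ⁻¹          ≈⟨ *-congʳ (+-congʳ (ι∣⌊scale⌋∣≈ η n)) ⟨
      (ι N + 1#) * y ⁻¹               ≡⟨ ≡.cong (λ c → (ι c + 1#) * y ⁻¹) (count-U N) ⟨
      (ι (count U N) + 1#) * y ⁻¹     ≈⟨ distribʳ _ _ _ ⟩
      density η U n + 1# * y ⁻¹       ≈⟨ +-congˡ (*-identityˡ _) ⟩
      density η U n + y ⁻¹            ∎
      where
      y = scale η n
      N = ℤ.∣ ⌊ y ⌋ ∣

    1≤limit : ∀ {L} → IsLimit ω (density η U) L → 1# ≤ L
    1≤limit {L} d→L = by-contradiction λ 1≰L →
      let h     = half (1# - L)
          0<h   = 0<half (x<y⇒0<y-x (≰⇒> 1≰L))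
          m , h⁻¹<m = archimedean (h ⁻¹)
      in ω.∅-small (ω.⊆-closed
           (λ {n} ((d<L+h , _) , m≤n) → <⇒≱ (begin-strict
              density η U n + scale η n ⁻¹
                ≤⟨ +-monoʳ-≤ _ (scale⁻¹≤ 0<h n (begin
                     h ⁻¹         ≤⟨ <⇒≤ h⁻¹<m ⟩
                     ι m          ≤⟨ ι-mono-≤ (ℕ.m≤n⇒m≤1+n m≤n) ⟩
                     ι (toℕ n)    ≤⟨ ι≤2^ (toℕ n) ⟩
                     2# ^ toℕ n   ≤⟨ 2^n≤scale η n ⟩
                     scale η n    ∎)) ⟩
              density η U n + h  <⟨ +-monoˡ-< h d<L+h ⟩
              L + h + h          ≈⟨ +-assoc L h h ⟩
              L + (h + h)        ≈⟨ +-congˡ (half+half (1# - L)) ⟩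
              L + (1# - L)       ≈⟨ +-comm _ _ ⟩
              1# - L + L         ≈⟨ //-rightDividesˡ L 1# ⟩
              1#                 ∎) (1≤density+scale⁻¹ n))
           (ω.∩-closed (d→L 0<h) (ω.tail-large m)))

  ν : Ω* → FinitelyAdditiveProbability
  ν η = record
    { measure  = densityLimit η
    ; cong     = densityLimit-cong η
    ; nonneg   = λ A → limit-mono (proj₁ η) (limit-const (proj₁ η) 0#)
                         (densityLimit-isLimit η A) (0≤density η A)
    ; total    = densityLimit-U η
    ; additive = densityLimit-∪ η
    }

  ν-cong : ∀ {η η′} → η ∼ η′ → ∀ A → measure (ν η) A ≈ measure (ν η′) A
  ν-cong η∼η′ A = EqClosure.gfold isEquivalence (λ η → measure (ν η) A) step η∼η′
    where
    density-cong : ∀ η η′ {m n} → scale η m ≈ scale η′ n → density η A m ≈ density η′ A n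
    density-cong η η′ {m} {n} eq = *-cong
      (reflexive (≡.cong (λ k → ι (count A ℤ.∣ k ∣)) (⌊⌋-cong eq)))
      (⁻¹-cong (0<scale η m) (0<scale η′ n) eq)

    step : ∀ {η η′} → Identified η η′ → densityLimit η A ≈ densityLimit η′ A
    step {η@(ω , t)} {η′@(ω′ , t′)} (equal ω≋ω′ t≈t′) = limit-unique ω′
      (λ 0<ε → proj₁ ω≋ω′ (densityLimit-isLimit η A 0<ε)) (densityLimit-isLimit η′ A)
      λ n → density-cong η η′ {n} {n} (*-congʳ (2^-cong t≈t′))
    step {η@(ω , t)} {η′@(ω′ , t′)} (glue t≈1 ω′≋τω t′≈0) = limit-unique ω
      (densityLimit-isLimit η A) (λ 0<ε → proj₁ ω′≋τω (densityLimit-isLimit η′ A 0<ε))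
      λ n → density-cong η η′ {n} {next n} (begin-equality
        2^[ t ] * 2# ^ toℕ n            ≈⟨ *-congʳ (2^1≈2 t≈1) ⟩
        2# * 2# ^ toℕ n                 ≈⟨ *-identityˡ _ ⟨
        1# * 2# ^ toℕ (next n)          ≈⟨ *-congʳ (2^0≈1 t′≈0) ⟨
        2^[ t′ ] * 2# ^ toℕ (next n)    ∎)

  StronglySingular : Rel FinitelyAdditiveProbability (lsuc 0ℓ)
  StronglySingular μ ν = ∃[ D ] (measure μ D ≈ 0# × measure ν (∁ D) ≈ 0#)

{-# OPTIONS --safe #-}

-- A null set of ν (ω , t) has small density in {1, …, 2 ^ n} for ω-almost all n.
-- If D is null for η = (ω , t) and ∁ D is null for η′ = (ω′ , t′), then the set
-- Half D of those n for which D fills at least half of {1, …, 2 ^ n} belongs to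
-- ω′ and τ⁻¹ ω′, but to no τ ^ (- k) ω with k ≥ 0; the flow box of length 2 over
-- Half D is then an open neighbourhood of η′ that misses o₋ η.
--
-- Conversely, a neighbourhood of η′ that misses o₋ η has a slice at height t′,
-- which gives A′ ∈ ω′ that lies in no τ ^ (- k) ω with k ≥ 1, nor in ω if t′ ≤ t.
-- With A ∈ ω obtained symmetrically and A, A′ shrunk to be disjoint, the last
-- element of A′ before n recedes from n along ω, and vice versa.  So the blocks
-- (2 ^ i , 2 ^ (i + 1)] with i in the gaps of A ∪ A′ that end in A′ have a union
-- that is null for ν η and conull for ν η′.  Only 1 ≤ 2 ^ t ≤ 2 is needed about
-- the exponential.

module Submission where

open import Axiom.ExcludedMiddle using (ExcludedMiddle)
open import Data.Integer.Base as ℤ using (+_; -[1+_])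
open import Data.List.Base using (length; applyUpTo; filter; []; _∷_)
open import Data.List.Properties using (applyUpTo-∷ʳ; filter-++; filter-reject; filter-≐; length-++)
open import Data.Nat.Base as ℕ using (ℕ; zero; suc)
import Data.Nat.Properties as ℕ
open import Data.Nat.Tactic.RingSolver using (solve-∀)
open import Data.Product.Base using (∃-syntax; _×_; _,_; proj₁; proj₂)
open import Data.Sum.Base using (_⊎_; inj₁; inj₂; [_,_]′)
open import Data.Unit.Base using (tt)
open import Function.Base using (_∘_; id)
open import Function.Bundles using (_⇔_; mk⇔; Equivalence)
open import Function.Properties.Equivalence using (⇔-isEquivalence)
open import Level using (0ℓ)
open import Relation.Binary.Definitions using (_Respects_)
open import Relation.Binary.PropositionalEquality as ≡ using (_≡_; module ≡-Reasoning)
open import Relation.Nullary using (¬_; yes; no; contradiction)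
open import Relation.Unary using (Pred; U; ∁; _∩_; _∪_; _∈_; _∉_; _⊢_)
import Relation.Binary.Construct.Closure.Equivalence as EqClosure
import Relation.Binary.Reasoning.PartialOrder
open import Defs

-- Sets that recede along an ultrafilter.

Ahead : Pred ℕ⁺ 0ℓ → ℕ → Pred ℕ⁺ 0ℓ
Ahead A m n = ∀ j → A j → toℕ j ℕ.≤ toℕ n → m ℕ.+ toℕ j ℕ.< toℕ n

module _ (ω : FreeUltrafilter) where

  private module ω = FreeUltrafilter ω

  large-∁ : ∀ {A} → ¬ large ω A → large ω (∁ A)
  large-∁ {A} A-small with ω.ultra A
  ... | inj₁ A-large  = contradiction A-large A-small
  ... | inj₂ ∁A-large = ∁A-large

  -- `τ⁻¹` is pushforward along `prev`, and `k` steps of `prev` are truncated subtraction of `k`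
  -- from the predecessor.
  τ^-large : ∀ k A → large ((τ^ ℤ.- (+ k)) ω) A ⇔ large ω (λ n → A (1+ (predecessor n ℕ.∸ k)))
  τ^-large zero          A = mk⇔ id id
  τ^-large (suc zero)    A = mk⇔ id id
  τ^-large (suc (suc k)) A = mk⇔
    (ω.⊆-closed (λ {n} → ≡.subst (A ∘ 1+_) (pred-∸ n)) ∘ Equivalence.to (τ^-large (suc k) (prev ⊢ A)))
    (Equivalence.from (τ^-large (suc k) (prev ⊢ A)) ∘ ω.⊆-closed (λ {n} → ≡.subst (A ∘ 1+_) (≡.sym (pred-∸ n))))
    where
    pred-∸ : ∀ n → ℕ.pred (predecessor n ℕ.∸ suc k) ≡ predecessor n ℕ.∸ suc (suc k)
    pred-∸ n = ℕ.pred[m∸n]≡m∸[1+n] (predecessor n) (suc k)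

  -- Avoiding `A` at shift `k` rules out the single distance `k` between `n` and an element of `A`
  -- below it. Excluding the distances 0, ..., `m` one by one leaves only those beyond `m`; distance
  -- 0 keeps `n` itself out of `A`.
  ahead-large : ∀ {A} → (∀ k → ¬ large ((τ^ ℤ.- (+ k)) ω) A) → ∀ m → large ω (Ahead A m)
  ahead-large {A} avoids = go
    where
    skips : ∀ k → large ω (λ n → ¬ A (1+ (predecessor n ℕ.∸ k)))
    skips k = large-∁ (avoids k ∘ Equivalence.from (τ^-large k A))

    strict : ∀ {n} k j → ¬ A (1+ (predecessor n ℕ.∸ k)) → A j →
             k ℕ.+ toℕ j ℕ.≤ toℕ n → k ℕ.+ toℕ j ℕ.< toℕ n
    strict {n} k j skip Aj k+j≤n = ℕ.≤∧≢⇒< k+j≤n λ k+j≡n → skip (≡.subst (A ∘ 1+_) (≡.sym (begin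
      predecessor n ℕ.∸ k             ≡⟨ ≡.cong (λ i → ℕ.pred i ℕ.∸ k) k+j≡n ⟨
      ℕ.pred (k ℕ.+ toℕ j) ℕ.∸ k      ≡⟨ ≡.cong (λ i → ℕ.pred i ℕ.∸ k) (ℕ.+-suc k (predecessor j)) ⟩
      k ℕ.+ predecessor j ℕ.∸ k       ≡⟨ ℕ.m+n∸m≡n k (predecessor j) ⟩
      predecessor j                   ∎)) Aj)
      where open ≡-Reasoning

    go : ∀ m → large ω (Ahead A m)
    go zero    = ω.⊆-closed (λ skip j Aj → strict 0 j skip Aj) (skips 0)
    go (suc m) = ω.⊆-closed
      (λ (ahead , skip) j Aj j≤n → strict (suc m) j skip Aj (ahead j Aj j≤n))
      (ω.∩-closed (go m) (skips (suc m)))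

τ-τ^ : ∀ k ω → τ ((τ^ k) ω) ≋ (τ^ ℤ.suc k) ω
τ-τ^ (+ n)          ω = id , id
τ-τ^ -[1+ zero ]    ω = τ-τ⁻¹ ω
τ-τ^ -[1+ suc n ]   ω = τ-τ⁻¹ ((τ^ -[1+ n ]) ω)

-- Proportions in a segment and in one `a` times as long.

module _ where

  open ℕ.≤-Reasoning

  dense-scaled : ∀ a {M N c c′} → N ≡ a ℕ.* M → M ℕ.≤ 2 ℕ.* c → c ℕ.≤ c′ → 2 ℕ.* N ℕ.≤ 2 ℕ.* (2 ℕ.* a) ℕ.* c′
  dense-scaled a {M} {N} {c} {c′} N≡aM M≤2c c≤c′ = begin
    2 ℕ.* N                     ≡⟨ ≡.cong (2 ℕ.*_) N≡aM ⟩
    2 ℕ.* (a ℕ.* M)             ≤⟨ ℕ.*-monoʳ-≤ 2 (ℕ.*-monoʳ-≤ a (ℕ.≤-trans M≤2c (ℕ.*-monoʳ-≤ 2 c≤c′))) ⟩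
    2 ℕ.* (a ℕ.* (2 ℕ.* c′))    ≡⟨ regroup a c′ ⟩
    2 ℕ.* (2 ℕ.* a) ℕ.* c′      ∎
    where
    regroup : ∀ a b → 2 ℕ.* (a ℕ.* (2 ℕ.* b)) ≡ 2 ℕ.* (2 ℕ.* a) ℕ.* b
    regroup = solve-∀

  sparse-scaled : ∀ a .⦃ _ : ℕ.NonZero a ⦄ {M N c c′} →
                  N ≡ a ℕ.* M → 2 ℕ.* a ℕ.* c′ ℕ.≤ N → c ℕ.≤ c′ → 2 ℕ.* c ℕ.≤ M
  sparse-scaled a {M} {N} {c} {c′} N≡aM sparse c≤c′ = ℕ.*-cancelˡ-≤ a (begin
    a ℕ.* (2 ℕ.* c)      ≤⟨ ℕ.*-monoʳ-≤ a (ℕ.*-monoʳ-≤ 2 c≤c′) ⟩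
    a ℕ.* (2 ℕ.* c′)     ≡⟨ regroup a c′ ⟩
    2 ℕ.* a ℕ.* c′       ≤⟨ sparse ⟩
    N                    ≡⟨ N≡aM ⟩
    a ℕ.* M              ∎)
    where
    regroup : ∀ a b → a ℕ.* (2 ℕ.* b) ≡ 2 ℕ.* a ℕ.* b
    regroup = solve-∀

  majority : ∀ d c {N} → d ℕ.+ c ≡ N → 2 ℕ.* c ℕ.≤ N → N ℕ.≤ 2 ℕ.* d
  majority d c {N} d+c≡N 2c≤N = ℕ.+-cancelʳ-≤ N N (2 ℕ.* d) (begin
    N ℕ.+ N                   ≡⟨ ≡.cong (N ℕ.+_) (ℕ.+-identityʳ N) ⟨
    2 ℕ.* N                   ≡⟨ ≡.cong (2 ℕ.*_) d+c≡N ⟨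
    2 ℕ.* (d ℕ.+ c)           ≡⟨ ℕ.*-distribˡ-+ 2 d c ⟩
    2 ℕ.* d ℕ.+ 2 ℕ.* c       ≤⟨ ℕ.+-monoʳ-≤ (2 ℕ.* d) 2c≤N ⟩
    2 ℕ.* d ℕ.+ N             ∎)

module Separation (em : ∀ {ℓ} → ExcludedMiddle ℓ) (ℝ : CompleteOrderedField) where

  open Suspension em ℝ
  open import Algebra.Properties.Semiring.Mult semiring using (×1-homo-*)
  open import Algebra.Properties.AbelianGroup +-abelianGroup using (ε⁻¹≈ε; //-rightDividesˡ; //-rightDividesʳ)
  open Relation.Binary.Reasoning.PartialOrder poset

  -- Counting in initial segments, and limits equal to zero.

  ι-2^ : ∀ n → ι (2 ℕ.^ n) ≈ 2# ^ n
  ι-2^ zero    = +-identityʳ 1#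
  ι-2^ (suc n) = begin-equality
    ι (2 ℕ.* 2 ℕ.^ n)   ≈⟨ ×1-homo-* 2 (2 ℕ.^ n) ⟩
    ι 2 * ι (2 ℕ.^ n)   ≈⟨ *-cong (+-congˡ (+-identityʳ 1#)) (ι-2^ n) ⟩
    2# * 2# ^ n         ∎

  count-suc : ∀ E N → count E (suc N) ≡ count E N ℕ.+ countIn E (1+ N ∷ [])
  count-suc E N = ≡.trans
    (≡.cong (countIn E) (≡.sym (applyUpTo-∷ʳ 1+_ N)))
    (≡.trans (≡.cong length (filter-++ (λ n → em {P = E n}) (applyUpTo 1+_ N) (1+ N ∷ [])))
             (length-++ (filter (λ n → em {P = E n}) (applyUpTo 1+_ N))))

  count-mono : ∀ E {M N} → M ℕ.≤ N → count E M ℕ.≤ count E N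
  count-mono E M≤N = go (ℕ.≤⇒≤′ M≤N)
    where
    go : ∀ {M N} → M ℕ.≤′ N → count E M ℕ.≤ count E N
    go ℕ.≤′-refl         = ℕ.≤-refl
    go (ℕ.≤′-step {N} M≤N) = ℕ.≤-trans (go M≤N)
      (ℕ.≤-trans (ℕ.m≤m+n _ _) (ℕ.≤-reflexive (≡.sym (count-suc E N))))

  -- The recursion descends from `N` to the largest element of `E`, and the count never exceeds that
  -- element.
  count-bound : ∀ E K B N → (∀ x → E x → toℕ x ℕ.≤ N → K ℕ.* toℕ x ℕ.≤ B) → K ℕ.* count E N ℕ.≤ B
  count-bound E K B zero    bound = ℕ.≤-trans (ℕ.≤-reflexive (ℕ.*-zeroʳ K)) ℕ.z≤n
  count-bound E K B (suc N) bound with em {P = E (1+ N)}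
  ... | yes e = ℕ.≤-trans (ℕ.*-monoʳ-≤ K (count≤ E (suc N))) (bound (1+ N) e ℕ.≤-refl)
  ... | no ¬e = ℕ.≤-trans
    (ℕ.≤-reflexive (≡.cong (K ℕ.*_) (≡.trans (count-suc E N)
      (≡.trans (≡.cong (λ ns → count E N ℕ.+ length ns) (filter-reject (λ n → em {P = E n}) ¬e))
               (ℕ.+-identityʳ _)))))
    (count-bound E K B N λ x Ex x≤N → bound x Ex (ℕ.m≤n⇒m≤1+n x≤N))

  count-∁ : ∀ E N → count E N ℕ.+ count (∁ E) N ≡ N
  count-∁ E N = ≡.trans (≡.sym (countIn-∪ {E} {∁ E} (λ _ (e , ¬e) → ¬e e) (applyUpTo 1+_ N)))
    (≡.trans (≡.cong length (filter-≐ (λ n → em {P = (E ∪ ∁ E) n}) (λ n → em {P = U n})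
               ((λ _ → tt) , λ {n} _ → E∪∁E n) (applyUpTo 1+_ N)))
             (count-U N))
    where
    E∪∁E : ∀ n → (E ∪ ∁ E) n
    E∪∁E n with em {P = E n}
    ... | yes e = inj₁ e
    ... | no ¬e = inj₂ ¬e

  -- The limit is tested at `ε = K ⁻¹`. Keeping `K` as a factor on the left later turns the bound
  -- into an inequality between natural numbers.
  limit≈0⇒ : ∀ ω {x L} → IsLimit ω x L → L ≈ 0# → ∀ m → large ω (λ n → ι (2 ℕ.^ m) * x n ≤ 1#)
  limit≈0⇒ ω {x} {L} x→L L≈0 m = ω.⊆-closed
    (λ {n} (x<L+ε , _) → begin
      K * x n        ≤⟨ *-monoʳ-≤ (0≤ι (2 ℕ.^ m)) (<⇒≤ x<L+ε) ⟩
      K * (L + K ⁻¹) ≈⟨ *-congˡ (+-congʳ L≈0) ⟩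
      K * (0# + K ⁻¹) ≈⟨ *-congˡ (+-identityˡ _) ⟩
      K * K ⁻¹       ≈⟨ KK⁻¹≈1 ⟩
      1#             ∎)
    (x→L 0<ε)
    where
    module ω = FreeUltrafilter ω
    K = ι (2 ℕ.^ m)

    0<K : 0# < K
    0<K = begin-strict
      0#      <⟨ 0<1 ⟩
      1#      ≤⟨ 1≤2^ m ⟩
      2# ^ m  ≈⟨ ι-2^ m ⟨
      K       ∎

    KK⁻¹≈1 : K * K ⁻¹ ≈ 1#
    KK⁻¹≈1 = *-inverseʳ (proj₂ 0<K ∘ sym)

    0<ε : 0# < K ⁻¹
    0<ε = 0<x⇒0≤x⁻¹ 0<K , λ 0≈K⁻¹ → 0≉1 (begin-equality
      0#        ≈⟨ zeroʳ K ⟨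
      K * 0#    ≈⟨ *-congˡ 0≈K⁻¹ ⟩
      K * K ⁻¹  ≈⟨ KK⁻¹≈1 ⟩
      1#        ∎)

  -- If `L` were positive, `x n` would exceed `L / 2` along `ω`, while a power of 2 above
  -- `(L / 2) ⁻¹` forces it below.
  limit≈0⇐ : ∀ ω {x L} → IsLimit ω x L → 0# ≤ L →
             (∀ m → large ω (λ n → ι (2 ℕ.^ m) * x n ≤ 1#)) → L ≈ 0#
  limit≈0⇐ ω {x} {L} x→L 0≤L small = antisym (by-contradiction positive) 0≤L
    where
    module ω = FreeUltrafilter ω

    positive : ¬ ¬ (L ≤ 0#)
    positive L≰0 =
      let h = half L
          0<h = 0<half (≰⇒> L≰0)
          m , h⁻¹<m = archimedean (h ⁻¹)
          K = ι (2 ℕ.^ m)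
      in ω.∅-small (ω.⊆-closed
           (λ {n} ((_ , L<x+h) , Kx≤1) → <⇒≱ h⁻¹<m (begin
             ι m              ≤⟨ ι≤2^ m ⟩
             2# ^ m           ≈⟨ ι-2^ m ⟨
             K                ≈⟨ *-identityʳ K ⟨
             K * 1#           ≈⟨ *-congˡ (*-inverseʳ (proj₂ 0<h ∘ sym)) ⟨
             K * (h * h ⁻¹)   ≈⟨ *-assoc K h (h ⁻¹) ⟨
             K * h * h ⁻¹     ≤⟨ *-monoˡ-≤ (0<x⇒0≤x⁻¹ 0<h) (*-monoʳ-≤ (0≤ι (2 ℕ.^ m)) (+-cancelʳ-≤ h (begin
               h + h      ≈⟨ half+half L ⟩
               L          ≤⟨ <⇒≤ L<x+h ⟩
               x n + h    ∎))) ⟩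
             K * x n * h ⁻¹   ≤⟨ *-monoˡ-≤ (0<x⇒0≤x⁻¹ 0<h) Kx≤1 ⟩
             1# * h ⁻¹        ≈⟨ *-identityˡ (h ⁻¹) ⟩
             h ⁻¹             ∎))
           (ω.∩-closed (x→L 0<h) (small m)))

  -- Null sets of `ν` read off the segments {1, ..., 2 ^ n}.

  size : Ω* → ℕ⁺ → ℕ
  size η n = ℤ.∣ ⌊ scale η n ⌋ ∣

  scale≤ : ∀ η n → scale η n ≤ ι (2 ℕ.^ suc (toℕ n))
  scale≤ (ω , t) n = begin
    2^[ t ] * 2# ^ toℕ n       ≤⟨ *-monoˡ-≤ (0≤2^ (toℕ n)) (proj₂ (proj₂ (2^-exists t)) λ {y} → RationalPower≤2 t {y}) ⟩
    2# ^ suc (toℕ n)           ≈⟨ ι-2^ (suc (toℕ n)) ⟨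
    ι (2 ℕ.^ suc (toℕ n))      ∎

  ≤scale : ∀ η n → ι (2 ℕ.^ toℕ n) ≤ scale η n
  ≤scale η n = ≤-trans (≤-reflexive (ι-2^ (toℕ n))) (2^n≤scale η n)

  size≤ : ∀ η n → size η n ℕ.≤ 2 ℕ.^ suc (toℕ n)
  size≤ η n = ι-cancel-≤ (begin
    ι (size η n)               ≈⟨ ι∣⌊scale⌋∣≈ η n ⟩
    ιℤ ⌊ scale η n ⌋           ≤⟨ proj₁ (⌊⌋-isFloor (scale η n)) ⟩
    scale η n                  ≤⟨ scale≤ η n ⟩
    ι (2 ℕ.^ suc (toℕ n))      ∎)

  ≤size : ∀ η n → 2 ℕ.^ toℕ n ℕ.≤ size η n
  ≤size η n with 2 ℕ.^ toℕ n ℕ.≤? size η n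
  ... | yes le = le
  ... | no nle = contradiction (begin
    ιℤ ⌊ scale η n ⌋ + 1#      ≈⟨ +-congʳ (ι∣⌊scale⌋∣≈ η n) ⟨
    ι (size η n) + 1#          ≈⟨ +-comm _ _ ⟩
    ι (suc (size η n))         ≤⟨ ι-mono-≤ (ℕ.≰⇒> nle) ⟩
    ι (2 ℕ.^ toℕ n)            ≤⟨ ≤scale η n ⟩
    scale η n                  ∎) (<⇒≱ (proj₂ (⌊⌋-isFloor (scale η n))))

  -- The segment used by `ν` contains {1, ..., 2 ^ n}, and its scale is at most twice `2 ^ n`. The
  -- lost factor 2 is recovered by using the limit at `suc m`.
  null⇒ : ∀ {ω t} E → measure (ν (ω , t)) E ≈ 0# → ∀ m →
          large ω (λ n → 2 ℕ.^ m ℕ.* count E (2 ℕ.^ toℕ n) ℕ.≤ 2 ℕ.^ toℕ n)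
  null⇒ {ω} {t} E null m = FreeUltrafilter.⊆-closed ω
    (λ {n} → sparse n) (limit≈0⇒ ω (densityLimit-isLimit η E) null (suc m))
    where
    η = ω , t

    sparse : ∀ n → ι (2 ℕ.^ suc m) * density η E n ≤ 1# →
             2 ℕ.^ m ℕ.* count E (2 ℕ.^ toℕ n) ℕ.≤ 2 ℕ.^ toℕ n
    sparse n Kd≤1 = ℕ.≤-trans
      (ℕ.*-monoʳ-≤ (2 ℕ.^ m) (count-mono E (≤size η n)))
      (ℕ.*-cancelˡ-≤ 2 (ℕ.≤-trans (ℕ.≤-reflexive (≡.sym (ℕ.*-assoc 2 (2 ℕ.^ m) c))) (ι-cancel-≤ (begin
        ι (2 ℕ.^ suc m ℕ.* c)       ≈⟨ ×1-homo-* (2 ℕ.^ suc m) c ⟩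
        K * ι c                     ≈⟨ *-congˡ (*-identityʳ (ι c)) ⟨
        K * (ι c * 1#)              ≈⟨ *-congˡ (*-congˡ (scale-inverse η n)) ⟨
        K * (ι c * (s * s ⁻¹))      ≈⟨ *-congˡ (*-congˡ (*-comm s (s ⁻¹))) ⟩
        K * (ι c * (s ⁻¹ * s))      ≈⟨ *-congˡ (*-assoc (ι c) (s ⁻¹) s) ⟨
        K * (density η E n * s)     ≈⟨ *-assoc K (density η E n) s ⟨
        K * density η E n * s       ≤⟨ *-monoˡ-≤ (<⇒≤ (0<scale η n)) Kd≤1 ⟩
        1# * s                      ≈⟨ *-identityˡ s ⟩
        s                           ≤⟨ scale≤ η n ⟩
        ι (2 ℕ.^ suc (toℕ n))       ∎))))
      where
      c = count E (size η n)
      s = scale η n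
      K = ι (2 ℕ.^ suc m)

  -- The range up to `2 ^ (n + 1)` covers the segment used by `ν` whatever `t` is, so a bound on the
  -- elements of `E` there bounds their number by `count-bound`.
  null⇐ : ∀ {ω t} E →
          (∀ m → large ω (λ n → ∀ x → E x → toℕ x ℕ.≤ 2 ℕ.^ suc (toℕ n) → 2 ℕ.^ m ℕ.* toℕ x ℕ.≤ 2 ℕ.^ toℕ n)) →
          measure (ν (ω , t)) E ≈ 0#
  null⇐ {ω} {t} E sparse = limit≈0⇐ ω (densityLimit-isLimit η E)
    (FinitelyAdditiveProbability.nonneg (ν η) E)
    λ m → FreeUltrafilter.⊆-closed ω (λ {n} → small m n) (sparse m)
    where
    η = ω , t

    small : ∀ m n → (∀ x → E x → toℕ x ℕ.≤ 2 ℕ.^ suc (toℕ n) → 2 ℕ.^ m ℕ.* toℕ x ℕ.≤ 2 ℕ.^ toℕ n) →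
            ι (2 ℕ.^ m) * density η E n ≤ 1#
    small m n bound = begin
      ι (2 ℕ.^ m) * (ι c * s ⁻¹)   ≈⟨ *-assoc (ι (2 ℕ.^ m)) (ι c) (s ⁻¹) ⟨
      ι (2 ℕ.^ m) * ι c * s ⁻¹     ≈⟨ *-congʳ (×1-homo-* (2 ℕ.^ m) c) ⟨
      ι (2 ℕ.^ m ℕ.* c) * s ⁻¹     ≤⟨ *-monoˡ-≤ (0<x⇒0≤x⁻¹ (0<scale η n)) (begin
        ι (2 ℕ.^ m ℕ.* c)            ≤⟨ ι-mono-≤ (count-bound E (2 ℕ.^ m) (2 ℕ.^ toℕ n) (size η n)
                                          λ x Ex x≤N → bound x Ex (ℕ.≤-trans x≤N (size≤ η n))) ⟩
        ι (2 ℕ.^ toℕ n)              ≤⟨ ≤scale η n ⟩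
        s                            ∎) ⟩
      s * s ⁻¹                     ≈⟨ scale-inverse η n ⟩
      1#                           ∎
      where
      c = count E (size η n)
      s = scale η n

  -- The backward orbit and the sets it avoids.

  ιℤ-neg : ∀ k → ιℤ (ℤ.- (+ k)) ≈ - ι k
  ιℤ-neg zero    = sym ε⁻¹≈ε
  ιℤ-neg (suc k) = refl

  -- For `t < 1` the floor of `x` is `k` and the pairs agree. For `t = 1` the floor is `k + 1` with
  -- fractional part 0, and the gluing identifies the two pairs.
  flow-represents : ∀ {ω t x} k → x ≈ value t + ιℤ k → ((τ^ k) ω , t) ∼ ((τ^ ⌊ x ⌋) ω , fractional x)
  flow-represents {ω} {t} {x} k x≈t+k with em {P = value t ≈ 1#}
  ... | yes t≈1 = EqClosure.return (glue t≈1
    (≡.subst (λ l → (τ^ l) ω ≋ τ ((τ^ k) ω)) (≡.sym ⌊x⌋≡) (proj₂ (τ-τ^ k ω) , proj₁ (τ-τ^ k ω)))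
    (begin-equality
      x - ιℤ ⌊ x ⌋          ≈⟨ +-congˡ (-‿cong (reflexive (≡.cong ιℤ ⌊x⌋≡))) ⟩
      x - ιℤ (ℤ.suc k)      ≈⟨ +-congʳ x≈ ⟩
      ιℤ (ℤ.suc k) - ιℤ (ℤ.suc k) ≈⟨ -‿inverseʳ _ ⟩
      0#                    ∎))
    where
    x≈ : x ≈ ιℤ (ℤ.suc k)
    x≈ = begin-equality
      x               ≈⟨ x≈t+k ⟩
      value t + ιℤ k  ≈⟨ +-congʳ t≈1 ⟩
      1# + ιℤ k       ≈⟨ +-comm _ _ ⟩
      ιℤ k + 1#       ≈⟨ ιℤ-suc k ⟨
      ιℤ (ℤ.suc k)    ∎

    ⌊x⌋≡ : ⌊ x ⌋ ≡ ℤ.suc k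
    ⌊x⌋≡ = floor-unique (⌊⌋-isFloor x) (≤-refl , x<x+ε 0<1) x≈
  ... | no  t≉1 = EqClosure.return (equal
    (≡.subst (λ l → (τ^ k) ω ≋ (τ^ l) ω) (≡.sym ⌊x⌋≡) (id , id))
    (begin-equality
      value t                 ≈⟨ //-rightDividesʳ (ιℤ k) (value t) ⟨
      value t + ιℤ k - ιℤ k   ≈⟨ +-congʳ x≈t+k ⟨
      x - ιℤ k                ≡⟨ ≡.cong (λ l → x - ιℤ l) ⌊x⌋≡ ⟨
      x - ιℤ ⌊ x ⌋            ∎))
    where
    ⌊x⌋≡ : ⌊ x ⌋ ≡ k
    ⌊x⌋≡ = floor-unique {l = k} (⌊⌋-isFloor x)
      ( (begin
          ιℤ k            ≈⟨ +-identityˡ _ ⟨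
          0# + ιℤ k       ≤⟨ +-monoˡ-≤ (ιℤ k) (0≤value t) ⟩
          value t + ιℤ k  ∎)
      , (begin-strict
          value t + ιℤ k  <⟨ +-monoˡ-< (ιℤ k) (value≤1 t , t≉1) ⟩
          1# + ιℤ k       ≈⟨ +-comm _ _ ⟩
          ιℤ k + 1#       ∎))
      x≈t+k

  -- When `t′ ≤ t + k`, flowing back from `(ω , t)` for time `t + k - t′ ≥ 0` reaches
  -- `(τ ^ (- k) ω , t′)`. If every `A` in `ω′` belonged to some such `τ ^ (- k) ω`, each
  -- neighbourhood of `(ω′ , t′)` would meet the orbit.
  avoiding-set : ∀ {ω t ω′ t′} → (ω′ , t′) ∉ closure (o₋ (ω , t)) →
    ∃[ A ] (large ω′ A × (∀ k → value t′ ≤ value t + ι k → ¬ large ((τ^ ℤ.- (+ k)) ω) A))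
  avoiding-set {ω} {t} {ω′} {t′} η′∉ = by-contradiction λ none → η′∉ λ V V-open η′∈V →
    let A , ε , A-large , 0<ε , A⊆V = IsOpen.neighborhood V-open η′∈V
    in by-contradiction λ disjoint → none (A , A-large , λ k t′≤t+k A-large′ →
         disjoint (((τ^ ℤ.- (+ k)) ω , t′) , past k t′≤t+k , A⊆V A-large′ (x<x+ε 0<ε , x<x+ε 0<ε)))
    where
    past : ∀ k → value t′ ≤ value t + ι k → ((τ^ ℤ.- (+ k)) ω , t′) ∈ o₋ (ω , t)
    past k t′≤t+k = s , 0≤s , flow-represents (ℤ.- (+ k)) (begin-equality
      value t - s     ≈⟨ +-congʳ (//-rightDividesˡ y (value t)) ⟨
      s + y - s       ≈⟨ +-congʳ (+-comm s y) ⟩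
      y + s - s       ≈⟨ //-rightDividesʳ s y ⟩
      y               ∎)
      where
      y = value t′ + ιℤ (ℤ.- (+ k))
      s = value t - y

      0≤s : 0# ≤ s
      0≤s = x+z≤y⇒x≤y-z y (begin
        0# + y                         ≈⟨ +-identityˡ y ⟩
        value t′ + ιℤ (ℤ.- (+ k))      ≈⟨ +-congˡ (ιℤ-neg k) ⟩
        value t′ - ι k                 ≤⟨ x≤y+z⇒x-z≤y (ι k) t′≤t+k ⟩
        value t                        ∎)

  -- From points outside the orbit closures to strong singularity.

  -- NextIn B A is the union of the blocks (2 ^ i , 2 ^ (i + 1)] for which the first
  -- element ≥ i of A ∪ B lies in B and not in A.
  NextIn : Pred ℕ⁺ 0ℓ → Pred ℕ⁺ 0ℓ → Pred ℕ⁺ 0ℓ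
  NextIn B A x = ∃[ n ] (B n × toℕ x ℕ.≤ 2 ℕ.^ suc (toℕ n) ×
    (∀ j → A j → toℕ j ℕ.≤ toℕ n → 2 ℕ.^ suc (toℕ j) ℕ.< toℕ x))

  2^-ahead : ∀ {m j n} → m ℕ.+ j ℕ.< n → 2 ℕ.^ m ℕ.* 2 ℕ.^ suc j ℕ.≤ 2 ℕ.^ n
  2^-ahead {m} {j} {n} m+j<n = ℕ.≤-trans
    (ℕ.≤-reflexive (≡.sym (ℕ.^-distribˡ-+-* 2 m (suc j))))
    (ℕ.^-monoʳ-≤ 2 (ℕ.≤-trans (ℕ.≤-reflexive (ℕ.+-suc m j)) m+j<n))

  -- Let `n` be in `A` and let `k` in `B` witness `x ≤ 2 ^ (n + 1)`. If `k ≥ n`, the clause for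
  -- `j = n` would put `x` beyond `2 ^ (n + 1)`. So `k < n`, and since `B` recedes,
  -- `x ≤ 2 ^ (k + 1)` is small against `2 ^ n`.
  null-NextIn : ∀ {ω t A B} → large ω A → (∀ m → large ω (Ahead B m)) →
                measure (ν (ω , t)) (NextIn B A) ≈ 0#
  null-NextIn {ω} {t} {A} {B} A-large ahead = null⇐ {ω} {t} (NextIn B A) λ m → ω.⊆-closed
    (λ { {n} (An , n-ahead) x (k , Bk , x≤2^k , first) x≤2^n →
       [ (λ k<n → ℕ.≤-trans (ℕ.*-monoʳ-≤ (2 ℕ.^ m) x≤2^k) (2^-ahead {m} (n-ahead k Bk (ℕ.<⇒≤ k<n))))
       , (λ n≤k → contradiction x≤2^n (ℕ.<⇒≱ (first n An n≤k)))
       ]′ (ℕ.<-≤-connex (toℕ k) (toℕ n)) })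
    (ω.∩-closed A-large (ahead m))
    where module ω = FreeUltrafilter ω

  -- Here `n` in `B` is itself the witness for each `x ≤ 2 ^ (n + 1)` with `2 ^ m x > 2 ^ n`,
  -- because the blocks of the elements of `A` up to `n` end before such `x`.
  null-∁NextIn : ∀ {ω t A B} → large ω B → (∀ m → large ω (Ahead A m)) →
                 measure (ν (ω , t)) (∁ (NextIn B A)) ≈ 0#
  null-∁NextIn {ω} {t} {A} {B} B-large ahead = null⇐ {ω} {t} (∁ (NextIn B A)) λ m → ω.⊆-closed
    (λ { {n} (Bn , n-ahead) x x∉ x≤2^n → ℕ.≮⇒≥ λ 2^n<2^mx → x∉
       (n , Bn , x≤2^n , λ j Aj j≤n → ℕ.*-cancelˡ-< (2 ℕ.^ m) _ _
         (ℕ.≤-<-trans (2^-ahead {m} (n-ahead j Aj j≤n)) 2^n<2^mx)) })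
    (ω.∩-closed B-large (ahead m))
    where module ω = FreeUltrafilter ω

  singular : ∀ {ω t ω′ t′ A A′} → large ω A → large ω′ A′ →
             (∀ k → ¬ large ((τ^ ℤ.- (+ k)) ω) A′) → (∀ k → ¬ large ((τ^ ℤ.- (+ k)) ω′) A) →
             StronglySingular (ν (ω , t)) (ν (ω′ , t′))
  singular {ω} {t} {ω′} {t′} {A} {A′} A-large A′-large ω-avoids ω′-avoids =
    NextIn A′ A ,
    null-NextIn {ω} {t} A-large (ahead-large ω ω-avoids) ,
    null-∁NextIn {ω′} {t′} A′-large (ahead-large ω′ ω′-avoids)

  -- Comparing heights supplies avoidance at `k = 0` for one ultrafilter only. Removing `A′` from
  -- `A` supplies it for the other, since `ω′` contains `A′`.
  disjointify : ∀ {ω ω′ A A′} → large ω A → large ω′ A′ →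
    (∀ k → ¬ large ((τ^ -[1+ k ]) ω) A′) → (∀ k → ¬ large ((τ^ -[1+ k ]) ω′) A) → ¬ large ω A′ →
    large ω (A ∩ ∁ A′) × (∀ k → ¬ large ((τ^ ℤ.- (+ k)) ω) A′) × (∀ k → ¬ large ((τ^ ℤ.- (+ k)) ω′) (A ∩ ∁ A′))
  disjointify {ω} {ω′} A-large A′-large ω-avoids ω′-avoids A′-small =
    FreeUltrafilter.∩-closed ω A-large (large-∁ ω A′-small) ,
    (λ { zero → A′-small ; (suc k) → ω-avoids k }) ,
    (λ { zero    → λ A∖A′ → ω′.∅-small (ω′.⊆-closed (λ ((_ , ¬a′) , a′) → ¬a′ a′) (ω′.∩-closed A∖A′ A′-large))
       ; (suc k) → ω′-avoids k ∘ FreeUltrafilter.⊆-closed ((τ^ -[1+ k ]) ω′) proj₁ })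
    where module ω′ = FreeUltrafilter ω′

  ≤+0 : ∀ {x y} → x ≤ y → x ≤ y + ι 0
  ≤+0 {x} {y} x≤y = ≤-trans x≤y (≤-reflexive (sym (+-identityʳ y)))

  ≤+suc : ∀ t t′ k → value t ≤ value t′ + ι (suc k)
  ≤+suc t t′ k = begin
    value t                  ≤⟨ value≤1 t ⟩
    1#                       ≈⟨ +-identityʳ 1# ⟨
    ι 1                      ≤⟨ ι-mono-≤ {1} {suc k} (ℕ.s≤s ℕ.z≤n) ⟩
    ι (suc k)                ≈⟨ +-identityˡ _ ⟨
    0# + ι (suc k)           ≤⟨ +-monoˡ-≤ (ι (suc k)) (0≤value t′) ⟩
    value t′ + ι (suc k)     ∎

  ∉closures⇒singular : ∀ {ω t ω′ t′} →
    (ω′ , t′) ∉ closure (o₋ (ω , t)) → (ω , t) ∉ closure (o₋ (ω′ , t′)) →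
    StronglySingular (ν (ω , t)) (ν (ω′ , t′))
  ∉closures⇒singular {ω} {t} {ω′} {t′} η′∉ η∉ =
    let A′ , A′-large , ω-avoids = avoiding-set {ω} {t} {ω′} {t′} η′∉
        A , A-large , ω′-avoids  = avoiding-set {ω′} {t′} {ω} {t} η∉
        ω-avoids₁ k  = ω-avoids (suc k) (≤+suc t′ t k)
        ω′-avoids₁ k = ω′-avoids (suc k) (≤+suc t t′ k)
    -- Shifts `k ≥ 1` are avoided for any heights in [0,1]; at `k = 0` the order of `t` and `t′`
    -- decides which set is shrunk.
    in [ (λ t′≤t →
           let A∖A′-large , ω-all , ω′-all =
                 disjointify {ω} {ω′} A-large A′-large ω-avoids₁ ω′-avoids₁ (ω-avoids 0 (≤+0 t′≤t))
           in singular {t = t} {t′ = t′} A∖A′-large A′-large ω-all ω′-all)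
       , (λ t≤t′ →
           let A′∖A-large , ω′-all , ω-all =
                 disjointify {ω′} {ω} A′-large A-large ω′-avoids₁ ω-avoids₁ (ω′-avoids 0 (≤+0 t≤t′))
           in singular {t = t} {t′ = t′} A-large A′∖A-large ω-all ω′-all)
       ]′ (total (value t′) (value t))

  -- From strong singularity to points outside the orbit closures.

  Half : Pred ℕ⁺ 0ℓ → Pred ℕ⁺ 0ℓ
  Half D n = 2 ℕ.^ toℕ n ℕ.≤ 2 ℕ.* count D (2 ℕ.^ toℕ n)

  -- Fails for n ≤ k, where the truncated n ∸ k of the index is replaced by 1.
  2^-back : ∀ ω k → large ω (λ n → 2 ℕ.^ toℕ n ≡ 2 ℕ.^ k ℕ.* 2 ℕ.^ toℕ (1+ (predecessor n ℕ.∸ k)))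
  2^-back ω k = FreeUltrafilter.⊆-closed ω (λ {n} k≤n → ≡.trans
    (≡.cong (2 ℕ.^_) (≡.sym (≡.trans (ℕ.+-suc k (predecessor n ℕ.∸ k)) (≡.cong suc (ℕ.m+[n∸m]≡n k≤n)))))
    (ℕ.^-distribˡ-+-* 2 k _)) (FreeUltrafilter.tail-large ω k)

  count-back : ∀ D n k → count D (2 ℕ.^ toℕ (1+ (predecessor n ℕ.∸ k))) ℕ.≤ count D (2 ℕ.^ toℕ n)
  count-back D n k = count-mono D (ℕ.^-monoʳ-≤ 2 (ℕ.s≤s (ℕ.m∸n≤m (predecessor n) k)))

  null⇒¬half : ∀ {ω t D} → measure (ν (ω , t)) D ≈ 0# → ∀ k → ¬ large ((τ^ ℤ.- (+ k)) ω) (Half D)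
  null⇒¬half {ω} {t} {D} null k half-large = ω.∅-small (ω.⊆-closed
    (λ {n} ((half , n-back) , sparse) →
      ℕ.<⇒≱ (ℕ.^-monoʳ-< 2 (ℕ.s≤s (ℕ.s≤s ℕ.z≤n)) (ℕ.n<1+n (toℕ n)))
        (ℕ.≤-trans (dense-scaled (2 ℕ.^ k) n-back half (count-back D n k)) sparse))
    (ω.∩-closed (ω.∩-closed (Equivalence.to (τ^-large ω k (Half D)) half-large) (2^-back ω k))
                -- Half of {1, ..., 2 ^ (n - k)} is a share of `2 ^ (- (k + 1))` in {1, ..., 2 ^ n};
                -- nullity at `k + 2` allows only half of that.
                (null⇒ {ω} {t} D null (suc (suc k)))))
    where module ω = FreeUltrafilter ω

  -- A share of at most `2 ^ (- (k + 1))` for `∁ D` in {1, ..., 2 ^ n} is at most half of {1, ..., 2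
  -- ^ (n - k)}, so `D` has the other half.
  co-null⇒half : ∀ {ω t D} → measure (ν (ω , t)) (∁ D) ≈ 0# → ∀ k → large ((τ^ ℤ.- (+ k)) ω) (Half D)
  co-null⇒half {ω} {t} {D} null k = Equivalence.from (τ^-large ω k (Half D)) (ω.⊆-closed
    (λ {n} (n-back , sparse) → majority (count D (level n)) (count (∁ D) (level n)) (count-∁ D (level n))
      (sparse-scaled (2 ℕ.^ k) ⦃ ℕ.m^n≢0 2 k ⦄ n-back sparse (count-back (∁ D) n k)))
    (ω.∩-closed (2^-back ω k) (null⇒ {ω} {t} (∁ D) null (suc k))))
    where
    module ω = FreeUltrafilter ω

    level : ℕ⁺ → ℕ
    level n = 2 ℕ.^ toℕ (1+ (predecessor n ℕ.∸ k))

  -- The image in Ω* of { ω | A ∈ ω } × (0 , 2) under the flow.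
  FlowBox : Pred ℕ⁺ 0ℓ → Pred Ω* 0ℓ
  FlowBox A (ω , t) = (0# < value t × large ω A) ⊎ (value t < 1# × large (τ⁻¹ ω) A)

  <-respʳ : ∀ {x y z} → y ≈ z → x < y → x < z
  <-respʳ {x} {y} {z} y≈z x<y = begin-strict
    x  <⟨ x<y ⟩
    y  ≈⟨ y≈z ⟩
    z  ∎

  <-respˡ : ∀ {x y z} → x ≈ y → x < z → y < z
  <-respˡ {x} {y} {z} x≈y x<z = begin-strict
    y  ≈⟨ x≈y ⟨
    x  <⟨ x<z ⟩
    z  ∎

  <-irrefl-≈ : ∀ {x y} → x ≈ y → ¬ (x < y)
  <-irrefl-≈ x≈y (_ , x≉y) = x≉y x≈y

  -- Across the gluing, the first alternative at height 1 becomes the second at height 0, as `τ⁻¹`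
  -- undoes `τ`; the heights rule out the other two.
  FlowBox-saturated : ∀ A → FlowBox A Respects _∼_
  FlowBox-saturated A η∼η′ = Equivalence.to (EqClosure.gfold ⇔-isEquivalence (FlowBox A) step η∼η′)
    where
    move : ∀ {ω ω′ t t′} → ω ≋ ω′ → value t ≈ value t′ → FlowBox A (ω , t) → FlowBox A (ω′ , t′)
    move ω≋ω′ t≈t′ (inj₁ (0<t , a)) = inj₁ (<-respʳ t≈t′ 0<t , proj₁ ω≋ω′ a)
    move ω≋ω′ t≈t′ (inj₂ (t<1 , a)) = inj₂ (<-respˡ t≈t′ t<1 , proj₁ ω≋ω′ a)

    step : ∀ {η η′} → Identified η η′ → FlowBox A η ⇔ FlowBox A η′
    step (equal {ω} {ω′} {t} {t′} ω≋ω′ t≈t′) =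
      mk⇔ (move {ω} {ω′} {t} {t′} ω≋ω′ t≈t′)
          (move {ω′} {ω} {t′} {t} (proj₂ ω≋ω′ , proj₁ ω≋ω′) (sym t≈t′))
    step (glue t≈1 ω′≋τω t′≈0) = mk⇔
      (λ { (inj₁ (_ , a))   → inj₂ (<-respˡ (sym t′≈0) 0<1 , proj₂ ω′≋τω a)
         ; (inj₂ (t<1 , _)) → contradiction t<1 (<-irrefl-≈ t≈1) })
      (λ { (inj₁ (0<t′ , _)) → contradiction 0<t′ (<-irrefl-≈ (sym t′≈0))
         ; (inj₂ (_ , a))    → inj₁ (<-respʳ (sym t≈1) 0<1 , proj₁ ω′≋τω a) })

  -- The radius is the distance to the excluded end, 0 or 1. The condition on `τ⁻¹ ω` is membership
  -- of `prev ⊢ A` in `ω`.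
  FlowBox-open : ∀ A → IsOpen (FlowBox A)
  FlowBox-open A = record
    { saturated    = FlowBox-saturated A
    ; neighborhood = λ
      { {ω} {t} (inj₁ (0<t , a)) → A , value t , a , 0<t , λ {ω′} {t′} a′ (_ , t<t′+t) →
          inj₁ (≰⇒> (λ t′≤0 → <⇒≱ t<t′+t (begin
            value t′ + value t   ≤⟨ +-monoˡ-≤ (value t) t′≤0 ⟩
            0# + value t         ≈⟨ +-identityˡ _ ⟩
            value t              ∎)) , a′)
      ; {ω} {t} (inj₂ (t<1 , a)) → (prev ⊢ A) , 1# - value t , a , x<y⇒0<y-x t<1 , λ {ω′} {t′} a′ (t′<t+ε , _) →
          inj₂ ((begin-strict
            value t′                   <⟨ t′<t+ε ⟩
            value t + (1# - value t)   ≈⟨ +-comm _ _ ⟩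
            1# - value t + value t     ≈⟨ //-rightDividesˡ (value t) 1# ⟩
            1#                         ∎) , a′)
      }
    }

  -- For a floor at most 0, either alternative puts `A` into some `τ ^ (- k) ω`. A positive floor
  -- forces `x = 1` at height 0, where only the second alternative remains, and it speaks of
  -- `τ⁻¹ (τ ω)`, that is of `ω`.
  FlowBox-misses : ∀ {ω A x} → (∀ k → ¬ large ((τ^ ℤ.- (+ k)) ω) A) → x ≤ 1# →
                   ¬ FlowBox A ((τ^ ⌊ x ⌋) ω , fractional x)
  FlowBox-misses {ω} {A} {x} avoids x≤1 = go ⌊ x ⌋ (proj₁ (⌊⌋-isFloor x)) (fractional x) refl
    where
    go : ∀ l → ιℤ l ≤ x → ∀ t → value t ≈ x - ιℤ l → ¬ FlowBox A ((τ^ l) ω , t)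
    go (+ zero)            l≤x t t≈ (inj₁ (_ , a)) = avoids 0 a
    go (+ zero)            l≤x t t≈ (inj₂ (_ , a)) = avoids 1 a
    go -[1+ m ]            l≤x t t≈ (inj₁ (_ , a)) = avoids (suc m) a
    go -[1+ m ]            l≤x t t≈ (inj₂ (_ , a)) = avoids (suc (suc m)) a
    go (+ suc n)           l≤x t t≈ (inj₁ (0<t , _)) = <⇒≱ 0<t (begin
      value t                    ≈⟨ t≈ ⟩
      x - ι (suc n)              ≤⟨ x≤y+z⇒x-z≤y (ι (suc n)) (begin
        x                  ≤⟨ x≤1 ⟩
        1#                 ≈⟨ +-identityʳ 1# ⟨
        ι 1                ≤⟨ ι-mono-≤ {1} {suc n} (ℕ.s≤s ℕ.z≤n) ⟩
        ι (suc n)          ≈⟨ +-identityˡ _ ⟨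
        0# + ι (suc n)     ∎) ⟩
      0#                         ∎)
    go (+ suc zero)        l≤x t t≈ (inj₂ (_ , a)) = avoids 0 (proj₁ (τ⁻¹-τ ω) a)
    go (+ suc (suc n))     l≤x t t≈ (inj₂ _)
      with ι-cancel-≤ {suc (suc n)} {1} (≤-trans l≤x (≤-trans x≤1 (≤-reflexive (sym (+-identityʳ 1#)))))
    ... | ℕ.s≤s ()

  ∉closure : ∀ {ω t ω′ t′ D} → measure (ν (ω , t)) D ≈ 0# → measure (ν (ω′ , t′)) (∁ D) ≈ 0# →
             (ω′ , t′) ∉ closure (o₋ (ω , t))
  ∉closure {ω} {t} {ω′} {t′} {D} null co-null η′∈ =
    let ζ , (s , 0≤s , ζ∼) , ζ∈ = η′∈ (FlowBox (Half D)) (FlowBox-open (Half D)) η′∈box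
    in FlowBox-misses {ω} {Half D} (null⇒¬half {ω} {t} {D} null)
         (≤-trans (x≤y+z⇒x-z≤y s (begin
           value t        ≈⟨ +-identityʳ _ ⟨
           value t + 0#   ≤⟨ +-monoʳ-≤ (value t) 0≤s ⟩
           value t + s    ∎)) (value≤1 t))
         (FlowBox-saturated (Half D) ζ∼ ζ∈)
    where
    half-large = co-null⇒half {ω′} {t′} {D} co-null

    η′∈box : FlowBox (Half D) (ω′ , t′)
    -- At height 0 only the second alternative is available, hence the need for `Half D` in `τ⁻¹ ω′`
    -- as well.
    η′∈box with em {P = 0# < value t′}
    ... | yes 0<t′ = inj₁ (0<t′ , half-large 0)
    ... | no  0≮t′ = inj₂ ((begin-strict
      value t′   ≤⟨ by-contradiction (0≮t′ ∘ ≰⇒>) ⟩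
      0#         <⟨ 0<1 ⟩
      1#         ∎) , half-large 1)

  singular⇒∉closures : ∀ {ω t ω′ t′} → StronglySingular (ν (ω , t)) (ν (ω′ , t′)) →
    (ω′ , t′) ∉ closure (o₋ (ω , t)) × (ω , t) ∉ closure (o₋ (ω′ , t′))
  singular⇒∉closures {ω} {t} {ω′} {t′} (D , null , co-null) =
    ∉closure {ω} {t} {ω′} {t′} {D} null co-null ,
    -- The roles are exchanged by passing to `∁ D`, whose complement is classically `D`.
    ∉closure {ω′} {t′} {ω} {t} {∁ D} co-null
      (trans (densityLimit-cong (ω , t) ((λ ¬¬d → by-contradiction ¬¬d) , λ d ¬d → ¬d d)) null)

theorem3p8 : (em : ∀ {ℓ} → ExcludedMiddle ℓ) (ℝ : CompleteOrderedField) →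
    let open Suspension em ℝ in
    (η η′ : Ω*) →
    StronglySingular (ν η) (ν η′) ⇔ (η′ ∉ closure (o₋ η) × η ∉ closure (o₋ η′))
theorem3p8 em ℝ (ω , t) (ω′ , t′) = mk⇔
  (singular⇒∉closures {ω} {t} {ω′} {t′})
  (λ (η′∉ , η∉) → ∉closures⇒singular {ω} {t} {ω′} {t′} η′∉ η∉)
  where open Separation em ℝ
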